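{- The problem $k$-DMLOT can be solved on all digraphs in time $2^{O(k\log^2 k)}\cdot n^{O(1)}$, and on acyclic digraphs in time $2^{O(k\log k)}\cdot n^{O(1)}$, where $n$ is the number of vertices. That is, there is an absolute constant $c$ such that: there is an algorithm which, given any digraph $D$ on $n$ vertices and any positive integer $k$, correctly decides whether $D$ contains an out-tree with at least $k$ leaves in time at most $c\cdot 2^{ck\log^2 k}\cdot n^{c}$; and there is an algorithm which, given any acyclic digraph $D$ on $n$ vertices and any positive integer $k$, correctly decides the same question in time at most $c\cdot 2^{ck\log k}\cdot n^{c}$.
   Context: Digraphs are finite, with no loops and no parallel arcs (directed 2-cycles are allowed). A digraph is acyclic if it has no directed cycle. A subdigraph $T$ of a digraph $D$ is an out-tree if $T$ is an oriented tree with only one vertex of in-degree zero (called the root); it need not be spanning. The leaves of $T$ are its vertices of out-degree zero in $T$. The problem $k$-DMLOT (parameterized Directed Maximum Leaf Out-Tree) is: given a digraph $D$ and a positive integral parameter $k$, decide whether $D$ contains an out-tree with at least $k$ leaves. -}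

module Defs where

open import Data.Bool using (Bool; T; _∧_; if_then_else_)
open import Data.Fin using (Fin; toℕ; fromℕ<; combine; remQuot)
open import Data.Fin.Properties using (toℕ<n; toℕ-combine; fromℕ<-toℕ; remQuot-combine)
open import Data.Fin.Subset using (Subset; _∈_; ∣_∣)
open import Data.List using (_∷_; _++_; [_]; length)
open import Data.List.Relation.Unary.Linked using (Linked)
open import Data.List.Relation.Unary.Unique.Propositional using (Unique)
open import Data.Nat using (ℕ; suc; _+_; _*_; _∸_; _≤_; _<?_; _≡ᵇ_)
open import Data.Product using (∃!; ∃-syntax; _×_; _,_; uncurry)
open import Data.Sum using (_⊎_)
open import Data.Vec using (tabulate; lookup)
open import Relation.Binary.Core using (Rel)
open import Relation.Binary.Construct.Closure.ReflexiveTransitive using (Star)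
open import Relation.Binary.Construct.Closure.Symmetric using (SymClosure)
open import Relation.Binary.PropositionalEquality using (_≡_; _≢_; sym; cong)
open import Relation.Nullary using (¬_; yes; no; contradiction)
open import Level using (0ℓ)

------------------------------------------------------------------------
-- Digraphs and out-trees

-- A Boolean arc matrix rules out parallel arcs; directed 2-cycles are allowed.
record Digraph (n : ℕ) : Set where
  field
    arc      : Fin n → Fin n → Bool
    loopless : ∀ v → ¬ T (arc v v)

  Arc : Rel (Fin n) 0ℓ
  Arc u v = T (arc u v)

-- A cycle v₁ v₂ … vₗ v₁ of R through ℓ ≥ m pairwise distinct vertices.
HasCycle : ∀ {A : Set} → Rel A 0ℓ → ℕ → Set
HasCycle {A} R m =
  ∃[ v ] ∃[ vs ] m ≤ length (v ∷ vs)
               × Unique {A = A} (v ∷ vs)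
               × Linked R (v ∷ vs ++ [ v ])

Acyclic : ∀ {n} → Digraph n → Set
Acyclic D = ¬ HasCycle (Digraph.Arc D) 2

record Subdigraph {n : ℕ} (D : Digraph n) : Set where
  field
    vertices : Subset n
    arc      : Fin n → Fin n → Bool

  Arc : Rel (Fin n) 0ℓ
  Arc u v = T (arc u v)

  field
    arc-in-D : ∀ {u v} → Arc u v → Digraph.Arc D u v
    tail∈    : ∀ {u v} → Arc u v → u ∈ vertices
    head∈    : ∀ {u v} → Arc u v → v ∈ vertices

  outDegree inDegree : Fin n → ℕ
  outDegree v = ∣ tabulate (λ w → arc v w) ∣
  inDegree  v = ∣ tabulate (λ u → arc u v) ∣

  leaves : Subset n
  leaves = tabulate (λ v → lookup vertices v ∧ (outDegree v ≡ᵇ 0))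

-- An oriented tree is an orientation of an undirected tree: no two vertices
-- are joined by arcs in both directions, and the underlying simple graph
-- (adjacency SymClosure Arc) is connected and has no cycle.
record IsOrientedTree {n : ℕ} {D : Digraph n} (S : Subdigraph D) : Set where
  open Subdigraph S
  field
    oriented  : ∀ {u v} → Arc u v → ¬ Arc v u
    connected : ∀ {u v} → u ∈ vertices → v ∈ vertices → Star (SymClosure Arc) u v
    cycleFree : ¬ HasCycle (SymClosure Arc) 3

record IsOutTree {n : ℕ} {D : Digraph n} (S : Subdigraph D) : Set where
  open Subdigraph S
  field
    orientedTree : IsOrientedTree S
    uniqueRoot   : ∃! _≡_ (λ r → r ∈ vertices × inDegree r ≡ 0)

HasOutTreeWithLeaves : ∀ {n} → Digraph n → ℕ → Set
HasOutTreeWithLeaves D k =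
  ∃[ S ] IsOutTree {D = D} S × k ≤ ∣ Subdigraph.leaves S ∣

------------------------------------------------------------------------
-- Model of computation
--
-- Random access machine programs with structured control flow, under the
-- unit-cost measure.  The only arithmetic is addition and truncated
-- subtraction: without multiplication, t steps lengthen the numbers by at
-- most t bits, so this measure is polynomially related to Turing machine
-- time.  (Bounds of the form 2^O(f(k)) · n^O(1) with f(k) ≥ log k for k ≥ 2
-- are insensitive to polynomial changes of the machine model.)
--
-- A machine has scalar registers and arrays of unbounded length with numbers
-- as cells.  Registers and arrays are named by constants of the program, so a
-- program uses finitely many of each; only cell indices are computed.

Reg Array : Set
Reg   = ℕ
Array = ℕ

data Program : Set where
  skip   : Program
  const  : (x : Reg) (c : ℕ) → Program                -- x := c
  add    : (x y z : Reg) → Program                    -- x := y + z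
  monus  : (x y z : Reg) → Program                    -- x := max(y - z, 0)
  load   : (x : Reg) (a : Array) (i : Reg) → Program  -- x := a[i]
  store  : (a : Array) (i x : Reg) → Program          -- a[i] := x
  _⨾_    : (p q : Program) → Program
  ifnz   : (x : Reg) (p q : Program) → Program        -- p if x ≠ 0, else q
  while  : (x : Reg) (p : Program) → Program          -- repeat p as long as x ≠ 0

infixr 5 _⨾_

record State : Set where
  constructor ⟨_,_⟩
  field
    reg  : Reg → ℕ
    cell : Array → ℕ → ℕ

open State public

_[_↦_] : ∀ {A : Set} → (ℕ → A) → ℕ → A → ℕ → A
(f [ i ↦ x ]) j = if j ≡ᵇ i then x else f j

setReg : Reg → ℕ → State → State
setReg x v s = ⟨ reg s [ x ↦ v ] , cell s ⟩

setCell : Array → ℕ → ℕ → State → State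
setCell a i v s = ⟨ reg s , cell s [ a ↦ cell s a [ i ↦ v ] ] ⟩

-- p ⊢ s ⇓ s′ [ t ]: started in state s, program p halts in state s′ after
-- exactly t steps, every elementary instruction and every test being a step.
data _⊢_⇓_[_] : Program → State → State → ℕ → Set where
  skip  : ∀ {s} → skip ⊢ s ⇓ s [ 1 ]
  const : ∀ {s x c} → const x c ⊢ s ⇓ setReg x c s [ 1 ]
  add   : ∀ {s x y z} → add x y z ⊢ s ⇓ setReg x (reg s y + reg s z) s [ 1 ]
  monus : ∀ {s x y z} → monus x y z ⊢ s ⇓ setReg x (reg s y ∸ reg s z) s [ 1 ]
  load  : ∀ {s x a i} → load x a i ⊢ s ⇓ setReg x (cell s a (reg s i)) s [ 1 ]
  store : ∀ {s a i x} → store a i x ⊢ s ⇓ setCell a (reg s i) (reg s x) s [ 1 ]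
  seq   : ∀ {s s′ s″ p q t u} →
          p ⊢ s ⇓ s′ [ t ] → q ⊢ s′ ⇓ s″ [ u ] → (p ⨾ q) ⊢ s ⇓ s″ [ t + u ]
  if-≢0 : ∀ {s s′ x p q t} → reg s x ≢ 0 →
          p ⊢ s ⇓ s′ [ t ] → ifnz x p q ⊢ s ⇓ s′ [ suc t ]
  if-≡0 : ∀ {s s′ x p q t} → reg s x ≡ 0 →
          q ⊢ s ⇓ s′ [ t ] → ifnz x p q ⊢ s ⇓ s′ [ suc t ]
  while-≢0 : ∀ {s s′ s″ x p t u} → reg s x ≢ 0 →
             p ⊢ s ⇓ s′ [ t ] → while x p ⊢ s′ ⇓ s″ [ u ] →
             while x p ⊢ s ⇓ s″ [ suc (t + u) ]
  while-≡0 : ∀ {s x p} → reg s x ≡ 0 → while x p ⊢ s ⇓ s [ 1 ]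

------------------------------------------------------------------------
-- Inputs and decision

adjacencyCells : ∀ {n} → Digraph n → ℕ → ℕ
adjacencyCells {n} D i with i <? n * n
... | no  _    = 0
... | yes i<n² = if uncurry (Digraph.arc D) (remQuot {n} n (fromℕ< i<n²)) then 1 else 0

-- Instance (D , k): register 0 holds n, register 1 holds k, array 0 holds the
-- adjacency matrix of D in row-major order; everything else is 0.
input : ∀ {n} → Digraph n → ℕ → State
input {n} D k =
  ⟨ ((λ _ → 0) [ 0 ↦ n ]) [ 1 ↦ k ]
  , (λ _ _ → 0) [ 0 ↦ adjacencyCells D ] ⟩

-- The answer is returned in register 0.
DecidesWithin : Program → State → Set → ℕ → Set
DecidesWithin p s Answer bound =
  ∃[ s′ ] ∃[ t ] p ⊢ s ⇓ s′ [ t ]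
               × t ≤ bound
               × ((reg s′ 0 ≡ 1 × Answer) ⊎ (reg s′ 0 ≡ 0 × ¬ Answer))

adjacencyCells-arc : ∀ {n} (D : Digraph n) (u v : Fin n) →
  adjacencyCells D (n * toℕ u + toℕ v) ≡ (if Digraph.arc D u v then 1 else 0)
adjacencyCells-arc {n} D u v rewrite sym (toℕ-combine u v)
  with toℕ (combine u v) <? n * n
... | no  ≮n² = contradiction (toℕ<n (combine u v)) ≮n²
... | yes <n²
  rewrite fromℕ<-toℕ (combine u v) <n² =
    cong (λ uv → if uncurry (Digraph.arc D) uv then 1 else 0) (remQuot-combine u v)

{-# OPTIONS --safe #-}
module Submission where

-- An out-tree with at least k leaves exists iff there are a root r and a set I such that at least k
-- vertices outside I can be reached from r by walks whose earlier vertices all lie in I; for k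
-- leaves take I to be the inner vertices.  The algorithm is the branching algorithm of Kneis, Langer
-- and Rossmanith.  It grows a tree from r: the vertex u on top of a stack of pending leaves
-- either becomes a leaf for good (is counted as red) or is expanded to all its out-neighbours
-- outside the tree.  If that yields a single new vertex, the next decision is forced: it is
-- expanded too.  This loses nothing when I is chosen minimal, because if the single new vertex
-- w were not in I, then u could be dropped from I, becoming a leaf in place of w.
-- Every unforced decision raises 2 · red + pending (plus 1 while a decision is forced),
-- so 2k decisions suffice to reach k leaves, and the number of leaves never drops after that.
-- Trying all roots and all 4^k sequences of decisions takes time O(4^k n³), which is within both
-- bounds.  A sequence of decisions is a number x < P = 4^k read as a binary fraction x / P:
-- doubling x modulo P yields its digits, so neither multiplication nor division is needed.

open import Defs
open import Data.Bool using (Bool; true; false; T; _∧_; _∨_; not; if_then_else_)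
open import Data.Bool.Properties using (T-∨; T-≡; T-∧; T?; T-not-≡)
open import Data.Empty using (⊥; ⊥-elim)
open import Data.Fin as Fin using (Fin; toℕ; fromℕ<)
open import Data.Fin.Properties using
  (_≟_; any?; suc-injective; toℕ<n; toℕ-injective; toℕ-fromℕ<; fromℕ<-toℕ; injective⇒≤)
open import Data.Fin.Subset as Subset using (Subset; ∣_∣)
import Data.Fin.Subset.Properties as Subset
open import Data.List as List using (List; []; _∷_; _++_; [_]; length; filter; map)
open import Data.List.Membership.DecPropositional using (_∈?_)
open import Data.List.Membership.Propositional using (_∈_; _∉_)
open import Data.List.Membership.Propositional.Properties
  using (∈-lookup; ∈-++⁺ˡ; ∈-++⁺ʳ; ∈-++⁻; ∈-allFin; ∈-filter⁺; ∈-filter⁻; ∈-∃++; ∈-map⁻)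
open import Data.List.Membership.Setoid.Properties using (index-injective)
open import Data.List.Properties
  using (length-++; length-map; length-tabulate; ++-assoc; ++-identityʳ; filter-accept; filter-reject)
open import Data.List.Relation.Binary.Permutation.Propositional using (_↭_; ↭-sym; ↭⇒↭ₛ)
open import Data.List.Relation.Binary.Permutation.Propositional.Properties using (∈-resp-↭; shift; shifts)
import Data.List.Relation.Binary.Permutation.Setoid.Properties as Permutation
open import Data.List.Relation.Unary.All as All using (All; []; _∷_)
open import Data.List.Relation.Unary.All.Properties using (¬Any⇒All¬)
open import Data.List.Relation.Unary.AllPairs as AllPairs using ([]; _∷_)
open import Data.List.Relation.Unary.Any using (here; there; index)
open import Data.List.Relation.Unary.Linked as Linked using (Linked; []; [-]; _∷_)
open import Data.List.Relation.Unary.Unique.Propositional using (Unique)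
import Data.List.Relation.Unary.Unique.Propositional.Properties as Unique
open import Data.Nat hiding (_≟_)
open import Data.Nat.Logarithm using (⌊log₂_⌋; ⌊log₂⌋-mono-≤)
open import Data.Nat.Properties hiding (_≟_; suc-injective)
open import Data.Nat.Solver using (module +-*-Solver)
open import Data.Product using (∃-syntax; _×_; _,_; proj₁; proj₂)
open import Data.Sum as Sum using (_⊎_; inj₁; inj₂; [_,_]′)
open import Data.Unit using (⊤; tt)
open import Data.Vec using (tabulate; lookup; []; _∷_; here; there)
open import Data.Vec.Properties using (lookup∘tabulate; []=⇒lookup; lookup⇒[]=)
open import Function using (_∘_; Equivalence)
open import Relation.Binary.Construct.Closure.ReflexiveTransitive using (Star; ε; _◅_; _◅◅_; reverse)
open import Relation.Binary.Construct.Closure.Symmetric using (SymClosure; fwd; bwd; symmetric)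
open import Relation.Binary.PropositionalEquality hiding ([_])
open import Relation.Nullary using (¬_; ¬?; Dec; yes; no; ⌊_⌋; contradiction)
open import Relation.Nullary.Decidable using (toWitness; fromWitness)

-- Hoare-style reasoning about programs

update-same : ∀ {A : Set} (f : ℕ → A) i x → (f [ i ↦ x ]) i ≡ x
update-same f i x with i ≡ᵇ i in eq
... | true  = refl
... | false = ⊥-elim (subst T eq (≡⇒≡ᵇ i i refl))

update-other : ∀ {A : Set} (f : ℕ → A) {i j} x → j ≢ i → (f [ i ↦ x ]) j ≡ f j
update-other f {i} {j} x j≢i with j ≡ᵇ i in eq
... | true  = contradiction (≡ᵇ⇒≡ j i (subst T (sym eq) tt)) j≢i
... | false = refl

-- The time is bounded rather than exact, so that branches of different cost can share one bound.
Run : Program → State → (State → Set) → ℕ → Set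
Run p s Q b = ∃[ s′ ] ∃[ t ] p ⊢ s ⇓ s′ [ t ] × t ≤ b × Q s′

run-weaken : ∀ {p s Q R b c} → b ≤ c → (∀ {s′} → Q s′ → R s′) → Run p s Q b → Run p s R c
run-weaken b≤c Q⇒R (s′ , t , d , t≤b , q) = s′ , t , d , ≤-trans t≤b b≤c , Q⇒R q

now : ∀ {p s s′ Q} → p ⊢ s ⇓ s′ [ 1 ] → Q s′ → Run p s Q 1
now d q = _ , 1 , d , ≤-refl , q

infixr 4 _then_
_then_ : ∀ {p q s s′ Q b} → p ⊢ s ⇓ s′ [ 1 ] → Run q s′ Q b → Run (p ⨾ q) s Q (suc b)
d then (s″ , t , e , t≤b , q) = s″ , suc t , seq d e , s≤s t≤b , q

run-if≢0 : ∀ {x p q s Q b} → reg s x ≢ 0 → Run p s Q b → Run (ifnz x p q) s Q (suc b)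
run-if≢0 ≢0 (s′ , t , d , t≤b , q) = s′ , suc t , if-≢0 ≢0 d , s≤s t≤b , q

run-if≡0 : ∀ {x p q s Q b} → reg s x ≡ 0 → Run q s Q b → Run (ifnz x p q) s Q (suc b)
run-if≡0 ≡0 (s′ , t , d , t≤b , q) = s′ , suc t , if-≡0 ≡0 d , s≤s t≤b , q

-- What a program leaves unchanged

writesReg : Program → Reg → Bool
writesReg skip           r = false
writesReg (const x _)    r = r ≡ᵇ x
writesReg (add x _ _)    r = r ≡ᵇ x
writesReg (monus x _ _)  r = r ≡ᵇ x
writesReg (load x _ _)   r = r ≡ᵇ x
writesReg (store _ _ _)  r = false
writesReg (p ⨾ q)        r = writesReg p r ∨ writesReg q r
writesReg (ifnz _ p q)   r = writesReg p r ∨ writesReg q r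
writesReg (while _ p)    r = writesReg p r

writesArray : Program → Array → Bool
writesArray (store a _ _) b = b ≡ᵇ a
writesArray (p ⨾ q)       b = writesArray p b ∨ writesArray q b
writesArray (ifnz _ p q)  b = writesArray p b ∨ writesArray q b
writesArray (while _ p)   b = writesArray p b
writesArray _             b = false

-- What a run preserves is read off the program text alone. The conditions are Boolean computations,
-- so for a concrete program and register `refl` proves them.
record Frame (p : Program) (s s′ : State) : Set where
  constructor mkFrame
  field
    regs   : ∀ r → writesReg p r ≡ false → reg s′ r ≡ reg s r
    arrays : ∀ a → writesArray p a ≡ false → cell s′ a ≡ cell s a

open Frame public

∨-falseˡ : ∀ {a b} → a ∨ b ≡ false → a ≡ false
∨-falseˡ {false} _ = refl

∨-falseʳ : ∀ {a b} → a ∨ b ≡ false → b ≡ false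
∨-falseʳ {false} e = e

update-unwritten : ∀ {A : Set} (f : ℕ → A) {i j} x → (j ≡ᵇ i) ≡ false → (f [ i ↦ x ]) j ≡ f j
update-unwritten f x eq rewrite eq = refl

frame-refl : ∀ {p s} → Frame p s s
frame-refl = mkFrame (λ _ _ → refl) (λ _ _ → refl)

frame-trans : ∀ {p s s′ s″} → Frame p s s′ → Frame p s′ s″ → Frame p s s″
frame-trans f g = mkFrame (λ r w → trans (regs g r w) (regs f r w))
                          (λ a w → trans (arrays g a w) (arrays f a w))

frame : ∀ {p s s′ t} → p ⊢ s ⇓ s′ [ t ] → Frame p s s′
frame skip = frame-refl
frame {s = s} const = mkFrame (λ r → update-unwritten (reg s) _) (λ _ _ → refl)
frame {s = s} add   = mkFrame (λ r → update-unwritten (reg s) _) (λ _ _ → refl)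
frame {s = s} monus = mkFrame (λ r → update-unwritten (reg s) _) (λ _ _ → refl)
frame {s = s} load  = mkFrame (λ r → update-unwritten (reg s) _) (λ _ _ → refl)
frame {s = s} store = mkFrame (λ _ _ → refl) (λ a → update-unwritten (cell s) _)
frame (seq d e) with frame d | frame e
... | f | g = mkFrame (λ r w → trans (regs g r (∨-falseʳ w)) (regs f r (∨-falseˡ w)))
                      (λ a w → trans (arrays g a (∨-falseʳ w)) (arrays f a (∨-falseˡ w)))
frame (if-≢0 _ d) with frame d
... | f = mkFrame (λ r w → regs f r (∨-falseˡ w)) (λ a w → arrays f a (∨-falseˡ w))
frame (if-≡0 _ d) with frame d
... | f = mkFrame (λ r w → regs f r (∨-falseʳ w)) (λ a w → arrays f a (∨-falseʳ w))
frame (while-≢0 _ d e) with frame d | frame e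
... | f | g = mkFrame (λ r w → trans (regs g r w) (regs f r w))
                      (λ a w → trans (arrays g a w) (arrays f a w))
frame (while-≡0 _) = frame-refl

run-frame : ∀ {p s Q b} → Run p s Q b → Run p s (λ s′ → Frame p s s′ × Q s′) b
run-frame (s′ , t , d , t≤b , q) = s′ , t , d , t≤b , frame d , q

-- The proof for q receives the frame of p, so the intermediate assertion needs to mention only what
-- p changes.
run-seq : ∀ {p q s Q R b c} → Run p s Q b → (∀ {s′} → Frame p s s′ → Q s′ → Run q s′ R c) →
          Run (p ⨾ q) s R (b + c)
run-seq (s′ , t , d , t≤b , q) next with next (frame d) q
... | s″ , u , e , u≤c , r = s″ , t + u , seq d e , +-mono-≤ t≤b u≤c , r

-- All loops of the program count a register down to 0. There are m rounds of at most b steps and m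
-- + 1 tests. The frame from `s₀` gives the body every fact about the initial state that no round
-- destroys.
countdown : ∀ {x p s₀ b} (Inv : ℕ → State → Set) (m : ℕ) →
  (∀ {j s} → j < m → Frame p s₀ s → reg s x ≡ suc j → Inv (suc j) s →
     Run p s (λ s′ → reg s′ x ≡ j × Inv j s′) b) →
  reg s₀ x ≡ m → Inv m s₀ → Run (while x p) s₀ (Inv 0) (suc (m * suc b))
countdown {x} {p} {s₀} {b} Inv m body = go m ≤-refl frame-refl
  where
  go : ∀ j {s} → j ≤ m → Frame p s₀ s → reg s x ≡ j → Inv j s →
       Run (while x p) s (Inv 0) (suc (j * suc b))
  go zero    _   _ x≡j inv = _ , 1 , while-≡0 x≡j , ≤-refl , inv
  go (suc j) j<m f x≡j inv with body j<m f x≡j inv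
  ... | s′ , t , d , t≤b , x≡j′ , inv′ with go j (<⇒≤ j<m) (frame-trans f (frame d)) x≡j′ inv′
  ...   | s″ , u , e , u≤c , q =
    s″ , suc (t + u) , while-≢0 (λ x≡0 → 1+n≢0 (trans (sym x≡j) x≡0)) d e ,
    s≤s (≤-trans (+-mono-≤ t≤b u≤c) (≤-reflexive (+-suc b (j * suc b)))) , q

-- The search

unique-lookup : ∀ {A : Set} {xs : List A} → Unique xs → ∀ {i j} → List.lookup xs i ≡ List.lookup xs j → i ≡ j
unique-lookup (_ ∷ _)  {Fin.zero}  {Fin.zero}  _ = refl
unique-lookup (p ∷ _)  {Fin.zero}  {Fin.suc j} e = contradiction e (All.lookup p (∈-lookup j))
unique-lookup (p ∷ _)  {Fin.suc i} {Fin.zero}  e = contradiction (sym e) (All.lookup p (∈-lookup i))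
unique-lookup (_ ∷ us) {Fin.suc i} {Fin.suc j} e = cong Fin.suc (unique-lookup us e)

unique-⊆⇒length≤ : ∀ {A : Set} {xs ys : List A} → Unique xs → (∀ {x} → x ∈ xs → x ∈ ys) → length xs ≤ length ys
unique-⊆⇒length≤ {A} {xs} us sub =
  injective⇒≤ {f = λ i → index (sub (∈-lookup {xs = xs} i))}
    (λ {i} {j} e → unique-lookup us
       (index-injective (setoid A) (sub (∈-lookup i)) (sub (∈-lookup j)) e))

unique⇒length≤n : ∀ {n} {xs : List (Fin n)} → Unique xs → length xs ≤ n
unique⇒length≤n {n} {xs} us =
  subst (length xs ≤_) (length-tabulate (λ i → i)) (unique-⊆⇒length≤ us (λ {x} _ → ∈-allFin x))

record Frontier (n : ℕ) : Set where
  constructor frontier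
  field
    mark  : Fin n → Bool
    stack : List (Fin n)
    fresh : ℕ

-- red counts the vertices that have become leaves for good; forced says that the top of the
-- stack must be expanded; choice encodes the remaining guesses as a binary fraction of P.
record Config (n : ℕ) : Set where
  constructor config
  field
    mark   : Fin n → Bool
    stack  : List (Fin n)
    red    : ℕ
    forced : Bool
    choice : ℕ

-- Comparing numbers gives the same case distinction as a cell update, which is what `mark-marks`
-- relies on.
marked : ∀ {n} → Fin n → (Fin n → Bool) → Fin n → Bool
marked v M w = (toℕ w ≡ᵇ toℕ v) ∨ M w

module Search {n : ℕ} (D : Digraph n) (P : ℕ) where
  open Digraph D

  visit : Fin n → Fin n → Frontier n → Frontier n
  visit u v f@(frontier M S c) =
    if arc u v then (if M v then f else frontier (marked v M) (v ∷ S) (suc c)) else f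

  -- Indices are visited downwards, in the order of the machine loop. The bound is irrelevant, so
  -- the result does not depend on which proof of it is at hand.
  scan : Fin n → ∀ j → .(j ≤ n) → Frontier n → Frontier n
  scan u zero    _   f = f
  scan u (suc j) j<n f = scan u j (<⇒≤ j<n) (visit u (fromℕ< j<n) f)

  -- An expanded vertex without new out-neighbours is a leaf after all and counts as red; exactly
  -- one new vertex forces the next decision.
  settle : ℕ → ℕ → Frontier n → Config n
  settle R y (frontier M S c) = config M S (if c ≡ᵇ 0 then suc R else R) (c ≡ᵇ 1) y

  grow : (Fin n → Bool) → Fin n → List (Fin n) → ℕ → ℕ → Config n
  grow M u S R y = settle R y (scan u n ≤-refl (frontier M S 0))

  -- The number y is already doubled here: its leading digit is 1 when P ≤ y, and subtracting P
  -- removes that digit.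
  branch : Bool → (Fin n → Bool) → Fin n → List (Fin n) → ℕ → ℕ → Config n
  branch true  M u S R y = grow M u S R (y ∸ P)
  branch false M u S R y = config M S (suc R) false y

  step : Config n → Config n
  step (config M []      R F     y) = config M [] R F y
  step (config M (u ∷ S) R true  y) = grow M u S R y
  step (config M (u ∷ S) R false y) = branch (P ≤ᵇ y + y) M u S R (y + y)

  run : ℕ → Config n → Config n
  run zero    c = c
  run (suc i) c = run i (step c)

  start : Fin n → ℕ → Config n
  start r y = config (marked r (λ _ → false)) [ r ] 0 false y

  -- Every step takes one vertex off the stack for good, so n steps empty it.
  outcome : Fin n → ℕ → ℕ
  outcome r y = Config.red (run n (start r y))

  record Extends (u : Fin n) (f f′ : Frontier n) (new : List (Fin n)) : Set where
    private
      module F  = Frontier f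
      module F′ = Frontier f′
    field
      stack≡  : F′.stack ≡ new ++ F.stack
      fresh≡  : F′.fresh ≡ length new + F.fresh
      unique  : Unique new
      arcs    : ∀ {v} → v ∈ new → Arc u v
      unseen  : ∀ {v} → v ∈ new → ¬ T (F.mark v)
      mark⁻   : ∀ v → T (F′.mark v) → v ∈ new ⊎ T (F.mark v)
      mark⁺   : ∀ {v} → v ∈ new ⊎ T (F.mark v) → T (F′.mark v)

  marked⁺ : ∀ v M {w : Fin n} → w ≡ v ⊎ T (M w) → T (marked v M w)
  marked⁺ v M (inj₁ refl) = Equivalence.from T-∨ (inj₁ (≡⇒≡ᵇ (toℕ v) _ refl))
  marked⁺ v M (inj₂ m)    = Equivalence.from T-∨ (inj₂ m)

  marked⁻ : ∀ v M {w : Fin n} → T (marked v M w) → w ≡ v ⊎ T (M w)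
  marked⁻ v M = Sum.map₁ (toℕ-injective ∘ ≡ᵇ⇒≡ _ _) ∘ Equivalence.to T-∨

  extends-refl : ∀ {u f} → Extends u f f []
  extends-refl = record
    { stack≡ = refl ; fresh≡ = refl ; unique = [] ; arcs = λ () ; unseen = λ ()
    ; mark⁻ = λ _ → inj₂ ; mark⁺ = λ { (inj₂ m) → m } }

  extends-trans : ∀ {u f f′ f″ new new′} → Extends u f f′ new → Extends u f′ f″ new′ →
                  Extends u f f″ (new′ ++ new)
  extends-trans {f = f} {new = new} {new′} e e′ = record
    { stack≡ = trans E′.stack≡ (trans (cong (new′ ++_) E.stack≡) (sym (++-assoc new′ new _)))
    ; fresh≡ = trans E′.fresh≡ (trans (cong (length new′ +_) E.fresh≡)
        (trans (sym (+-assoc (length new′) (length new) _)) (cong (_+ Frontier.fresh f) (sym (length-++ new′)))))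
    ; unique = Unique.++⁺ E′.unique E.unique (λ (p , q) → E′.unseen p (E.mark⁺ (inj₁ q)))
    ; arcs = λ p → [ E′.arcs , E.arcs ]′ (∈-++⁻ new′ p)
    ; unseen = λ p m → [ (λ q → E′.unseen q (E.mark⁺ (inj₂ m))) , (λ q → E.unseen q m) ]′ (∈-++⁻ new′ p)
    ; mark⁻ = λ v m → [ inj₁ ∘ ∈-++⁺ˡ , Sum.map₁ (∈-++⁺ʳ new′) ∘ E.mark⁻ v ]′ (E′.mark⁻ v m)
    ; mark⁺ = [ (λ p → E′.mark⁺ (Sum.map₂ (E.mark⁺ ∘ inj₁) (∈-++⁻ new′ p)))
              , (λ m → E′.mark⁺ (inj₂ (E.mark⁺ (inj₂ m)))) ]′
    }
    where module E  = Extends e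
          module E′ = Extends e′

  visit-extends : ∀ u v f → ∃[ new ] Extends u f (visit u v f) new × (Arc u v → T (Frontier.mark (visit u v f) v))
  visit-extends u v f@(frontier M S c) with arc u v in a
  ... | false = [] , extends-refl , λ ()
  ... | true with M v in m
  ...   | true  = [] , extends-refl , λ _ → subst T (sym m) tt
  ...   | false = [ v ] , record
    { stack≡ = refl ; fresh≡ = refl ; unique = [] ∷ []
    ; arcs = λ { (here refl) → subst T (sym a) tt }
    ; unseen = λ { (here refl) → subst T m }
    ; mark⁻ = λ w m → Sum.map₁ here (marked⁻ v M m)
    ; mark⁺ = λ { (inj₁ (here e)) → marked⁺ v M (inj₁ e) ; (inj₂ m) → marked⁺ v M (inj₂ m) }
    } , λ _ → marked⁺ v M (inj₁ refl)

  scan-extends : ∀ u j .(j≤n : j ≤ n) f → ∃[ new ] Extends u f (scan u j j≤n f) new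
                 × (∀ v → toℕ v < j → Arc u v → T (Frontier.mark (scan u j j≤n f) v))
  scan-extends u zero    _   f = [] , extends-refl , λ _ ()
  scan-extends u (suc j) j<n f
    with visit-extends u (fromℕ< j<n) f
  ... | new , e , visited with scan-extends u j (<⇒≤ j<n) (visit u (fromℕ< j<n) f)
  ...   | new′ , e′ , scanned = new′ ++ new , extends-trans e e′ , covered
    where
    covered : ∀ v → toℕ v < suc j → Arc u v → T (Frontier.mark (scan u (suc j) j<n f) v)
    covered v v<1+j a with m≤n⇒m<n∨m≡n (≤-pred v<1+j)
    ... | inj₁ v<j = scanned v v<j a
    ... | inj₂ refl rewrite fromℕ<-toℕ v j<n = Extends.mark⁺ e′ (inj₂ (visited a))

  -- The list `new` and the marks `M′` are independent of y: an expansion passes the remaining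
  -- guesses on untouched. By `complete`, all out-neighbours of u lie in the tree afterwards.
  record Grown (M : Fin n → Bool) (u : Fin n) (S : List (Fin n)) (R : ℕ) : Set where
    field
      new      : List (Fin n)
      M′       : Fin n → Bool
      grown≡   : ∀ y → grow M u S R y ≡
                 config M′ (new ++ S) (if length new ≡ᵇ 0 then suc R else R) (length new ≡ᵇ 1) y
      unique   : Unique new
      arcs     : ∀ {v} → v ∈ new → Arc u v
      unseen   : ∀ {v} → v ∈ new → ¬ T (M v)
      mark⁻    : ∀ v → T (M′ v) → v ∈ new ⊎ T (M v)
      mark⁺    : ∀ {v} → v ∈ new ⊎ T (M v) → T (M′ v)
      complete : ∀ {v} → Arc u v → T (M′ v)

  grown : ∀ M u S R → Grown M u S R
  grown M u S R with scan-extends u n ≤-refl (frontier M S 0)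
  ... | new , e , covered = record
    { new = new
    ; M′ = F′.mark
    ; grown≡ = λ y → cong₂ (λ S′ c → config F′.mark S′ (if c ≡ᵇ 0 then suc R else R) (c ≡ᵇ 1) y)
                 E.stack≡ (trans E.fresh≡ (+-identityʳ _))
    ; unique = E.unique ; arcs = E.arcs ; unseen = E.unseen
    ; mark⁻ = E.mark⁻ ; mark⁺ = E.mark⁺
    ; complete = covered _ (toℕ<n _)
    }
    where module E = Extends e
          module F′ = Frontier (scan u n ≤-refl (frontier M S 0))

-- Accepted runs yield out-trees

Unique-resp-↭ : ∀ {A : Set} {xs ys : List A} → xs ↭ ys → Unique xs → Unique ys
Unique-resp-↭ {A} p = Permutation.Unique-resp-↭ (setoid A) (↭⇒↭ₛ p)

∈-tabulate⁺ : ∀ {n} {f : Fin n → Bool} {v} → T (f v) → v Subset.∈ tabulate f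
∈-tabulate⁺ {f = f} {v} t = lookup⇒[]= v (tabulate f) (trans (lookup∘tabulate f v) (Equivalence.to T-≡ t))

∈-tabulate⁻ : ∀ {n} {f : Fin n → Bool} {v} → v Subset.∈ tabulate f → T (f v)
∈-tabulate⁻ {f = f} {v} m = Equivalence.from T-≡ (trans (sym (lookup∘tabulate f v)) ([]=⇒lookup m))

∣tabulate∣≡0⁻ : ∀ {n} {f : Fin n → Bool} → ∣ tabulate f ∣ ≡ 0 → ∀ v → ¬ T (f v)
∣tabulate∣≡0⁻ {f = f} e v t =
  n≮0 (subst (∣ tabulate f Subset.- v ∣ <_) e (Subset.x∈p⇒∣p-x∣<∣p∣ (∈-tabulate⁺ {f = f} t)))

∣tabulate∣≡0⁺ : ∀ {n} {f : Fin n → Bool} → (∀ v → ¬ T (f v)) → ∣ tabulate f ∣ ≡ 0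
∣tabulate∣≡0⁺ {zero}  none = refl
∣tabulate∣≡0⁺ {suc n} {f} none with f Fin.zero in e
... | true  = ⊥-elim (none Fin.zero (subst T (sym e) tt))
... | false = ∣tabulate∣≡0⁺ (none ∘ Fin.suc)

unique⇒length≤∣p∣ : ∀ {n} {xs : List (Fin n)} (p : Subset n) → Unique xs →
                    (∀ {x} → x ∈ xs → x Subset.∈ p) → length xs ≤ ∣ p ∣
unique⇒length≤∣p∣ p [] sub = z≤n
unique⇒length≤∣p∣ {xs = x ∷ xs} p (x∉ ∷ us) sub =
  ≤-trans (s≤s (unique⇒length≤∣p∣ (p Subset.- x) us
            (λ y∈ → Subset.x∈p∧x≢y⇒x∈p-y (sub (there y∈)) (λ y≡x → All.lookup x∉ y∈ (sym y≡x)))))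
          (Subset.x∈p⇒∣p-x∣<∣p∣ (sub (here refl)))

++-uniqueˡ : ∀ {A : Set} (xs : List A) {ys} → Unique (xs ++ ys) → Unique xs
++-uniqueˡ []       _        = []
++-uniqueˡ (x ∷ xs) (p ∷ us) = All.tabulate (All.lookup p ∘ ∈-++⁺ˡ) ∷ ++-uniqueˡ xs us

-- Out-trees given by parent functions

module _ {n : ℕ} (D : Digraph n) where
  open Digraph D

  -- A tree with root r on the marked vertices. The strict growth of `rank` from parent to child
  -- excludes cycles and makes every chain of parents end in r; values outside the tree are
  -- arbitrary.
  record Parents (r : Fin n) (M : Fin n → Bool) : Set where
    field
      par     : Fin n → Fin n
      rank    : Fin n → ℕ
      root    : T (M r)
      par∈    : ∀ {v} → T (M v) → v ≢ r → T (M (par v))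
      par-arc : ∀ {v} → T (M v) → v ≢ r → Arc (par v) v
      rank<   : ∀ {v} → T (M v) → v ≢ r → rank (par v) < rank v

    Childless : Fin n → Set
    Childless v = ∀ w → T (M w) → w ≢ r → par w ≢ v

  module Tree {r : Fin n} {M : Fin n → Bool} (t : Parents r M) where
    open Parents t

    Edge : Fin n → Fin n → Set
    Edge u v = T (M v) × v ≢ r × par v ≡ u

    edge? : ∀ u v → Dec (Edge u v)
    edge? u v with T? (M v) | v ≟ r | par v ≟ u
    ... | no ¬m | _     | _     = no (¬m ∘ proj₁)
    ... | yes _ | yes e | _     = no (λ (_ , ne , _) → ne e)
    ... | yes _ | no _  | no ne = no (λ (_ , _ , e) → ne e)
    ... | yes m | no ne | yes e = yes (m , ne , e)

    tree : Subdigraph D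
    tree = record
      { vertices = tabulate M
      ; arc      = λ u v → ⌊ edge? u v ⌋
      ; arc-in-D = λ {u} {v} a → arc-D (toWitness a)
      ; tail∈    = λ a → tail (toWitness a)
      ; head∈    = λ a → ∈-tabulate⁺ (proj₁ (toWitness a))
      }
      where
      arc-D : ∀ {u v} → Edge u v → Arc u v
      arc-D (m , v≢r , refl) = par-arc m v≢r
      tail : ∀ {u v} → Edge u v → u Subset.∈ tabulate M
      tail (m , v≢r , refl) = ∈-tabulate⁺ (par∈ m v≢r)

    TreeArc : Fin n → Fin n → Set
    TreeArc = Subdigraph.Arc tree

    edge-rank : ∀ {u v} → TreeArc u v → rank u < rank v
    edge-rank a with toWitness a
    ... | m , v≢r , refl = rank< m v≢r

    same-tail : ∀ {u u′ v} → TreeArc u v → TreeArc u′ v → u ≡ u′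
    same-tail a b = let _ , _ , e = toWitness a ; _ , _ , e′ = toWitness b in trans (sym e) e′

    to-root : ∀ k {v} → rank v ≤ k → T (M v) → Star (SymClosure TreeArc) v r
    to-root k {v} b m with v ≟ r
    ... | yes refl = ε
    to-root zero    b m | no v≢r = contradiction (≤-trans (rank< m v≢r) b) n≮0
    to-root (suc k) b m | no v≢r =
      bwd (fromWitness (m , v≢r , refl)) ◅ to-root k (≤-pred (≤-trans (rank< m v≢r) b)) (par∈ m v≢r)

    -- A walk without backtracking in the tree climbs towards the root first and then descends.
    descend : ∀ {x y t} l → TreeArc x y → Linked (SymClosure TreeArc) (y ∷ l ++ [ t ]) →
              Unique (x ∷ y ∷ l) → t ∉ x ∷ y ∷ l → ∃[ p ] TreeArc p t × rank x < rank t × p ∈ y ∷ l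
    descend [] a (fwd b ∷ _) _ _ = _ , b , <-trans (edge-rank a) (edge-rank b) , here refl
    descend [] a (bwd b ∷ _) _ t∉ = contradiction (here (same-tail b a)) t∉
    descend (z ∷ l) a (bwd b ∷ _) ((_ ∷ x≢z ∷ _) ∷ _) _ = contradiction (same-tail a b) x≢z
    descend (z ∷ l) a (fwd b ∷ w) (_ ∷ us) t∉ with descend l b w us (t∉ ∘ there)
    ... | p , pt , lt , p∈ = p , pt , <-trans (edge-rank a) lt , there p∈

    -- Either the walk climbs all the way to t, or it turns downwards once, stays downward by
    -- `descend`, and enters t from a parent on the walk.
    climb : ∀ {y t} l → Linked (SymClosure TreeArc) (y ∷ l ++ [ t ]) → Unique (y ∷ l) → t ∉ y ∷ l →
            rank t < rank y ⊎ (∃[ p ] TreeArc p t × p ∈ y ∷ l)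
    climb []      (fwd b ∷ _) _ _ = inj₂ (_ , b , here refl)
    climb []      (bwd b ∷ _) _ _ = inj₁ (edge-rank b)
    climb (z ∷ l) (fwd b ∷ w) us t∉ with descend l b w us t∉
    ... | p , pt , _ , p∈ = inj₂ (p , pt , there p∈)
    climb (z ∷ l) (bwd b ∷ w) (_ ∷ us) t∉ with climb l w us (t∉ ∘ there)
    ... | inj₁ lt            = inj₁ (<-trans lt (edge-rank b))
    ... | inj₂ (p , pt , p∈) = inj₂ (p , pt , there p∈)

    -- Around a cycle either the rank changes strictly in one direction, which is absurd on
    -- returning to v, or some vertex has two distinct parents. The directions of the first two
    -- arcs, with `descend` or `climb` for the rest, decide which.
    cycle-free : ¬ HasCycle (SymClosure TreeArc) 3
    cycle-free (v , []        , s≤s () , _)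
    cycle-free (v , _ ∷ []    , s≤s (s≤s ()) , _)
    cycle-free (v , y ∷ z ∷ l , _ , ((v≢y ∷ v≢z ∷ v∉l) ∷ us@((y∉ ∷ us′))) , first ∷ second ∷ w) =
      go first second
      where
      v∉z∷l : v ∉ z ∷ l
      v∉z∷l p = All.lookup (v≢z ∷ v∉l) p refl
      v∉y∷z∷l : v ∉ y ∷ z ∷ l
      v∉y∷z∷l p = All.lookup (v≢y ∷ v≢z ∷ v∉l) p refl
      go : SymClosure TreeArc v y → SymClosure TreeArc y z → _
      go (fwd a) (bwd b) = v≢z (same-tail a b)
      go (fwd a) (fwd b) with descend l b w us v∉y∷z∷l
      ... | p , pv , lt , _ = <-asym (edge-rank a) lt
      go (bwd a) (fwd b) with descend l b w us v∉y∷z∷l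
      ... | p , pv , _ , p∈ = All.lookup y∉ p∈ (same-tail a pv)
      go (bwd a) (bwd b) with climb l w us′ v∉z∷l
      ... | inj₁ lt            = <-asym (<-trans lt (edge-rank b)) (edge-rank a)
      ... | inj₂ (p , pv , p∈) = All.lookup y∉ p∈ (same-tail a pv)

    isOutTree : IsOutTree tree
    isOutTree = record
      { orientedTree = record
        { oriented  = λ a b → <-asym (edge-rank a) (edge-rank b)
        ; connected = λ u∈ v∈ → to-root _ ≤-refl (∈-tabulate⁻ u∈)
                        ◅◅ reverse (symmetric TreeArc) (to-root _ ≤-refl (∈-tabulate⁻ v∈))
        ; cycleFree = cycle-free
        }
      ; uniqueRoot = r , (∈-tabulate⁺ root , ∣tabulate∣≡0⁺ (λ u a → proj₁ (proj₂ (toWitness {a? = edge? u r} a)) refl))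
                       , λ (v∈ , e) → unique-root (∈-tabulate⁻ v∈) e
      }
      where
      unique-root : ∀ {v} → T (M v) → Subdigraph.inDegree tree v ≡ 0 → r ≡ v
      unique-root {v} m e with v ≟ r
      ... | yes v≡r = sym v≡r
      ... | no  v≢r = contradiction (fromWitness (m , v≢r , refl)) (∣tabulate∣≡0⁻ e (par v))

    childless-leaf : ∀ {v} → T (M v) → Childless v → v Subset.∈ Subdigraph.leaves tree
    childless-leaf {v} m ch = ∈-tabulate⁺ (Equivalence.from T-∧
      ( subst T (sym (lookup∘tabulate M v)) m
      , ≡⇒≡ᵇ _ 0 (∣tabulate∣≡0⁺ (λ w a → let m′ , w≢r , e = toWitness {a? = edge? v w} a in ch w m′ w≢r e))))

  parents⇒outTree : ∀ {r M k} (t : Parents r M) {ls : List (Fin n)} → Unique ls → k ≤ length ls →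
                    (∀ {v} → v ∈ ls → T (M v) × Parents.Childless t v) → HasOutTreeWithLeaves D k
  parents⇒outTree t us k≤ ch =
    tree , isOutTree , ≤-trans k≤ (unique⇒length≤∣p∣ _ us (λ v∈ → let m , c = ch v∈ in childless-leaf m c))
    where open Tree t

  -- L lists the vertices counted by red.
  Sound : Fin n → Config n → Set
  Sound r (config M S R _ _) =
    ∃[ L ] ∃[ t ] Unique (L ++ S) × length L ≡ R ×
    (∀ {v} → v ∈ L ++ S → T (M v) × Parents.Childless {r} {M} t v)

  -- Soundness is preserved by every step

  module _ (P : ℕ) where
    open Search D P

    start-sound : ∀ r y → Sound r (start r y)
    start-sound r y = [] , record
      { par = λ _ → r ; rank = λ _ → 0 ; root = marked⁺ r (λ _ → false) (inj₁ refl)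
      ; par∈ = λ m v≢r → contradiction (only m) v≢r
      ; par-arc = λ m v≢r → contradiction (only m) v≢r
      ; rank< = λ m v≢r → contradiction (only m) v≢r }
      , [] ∷ [] , refl
      , λ { (here refl) → marked⁺ r (λ _ → false) (inj₁ refl) , λ _ m w≢r _ → w≢r (only m) }
      where
      only : ∀ {v} → T (marked r (λ _ → false) v) → v ≡ r
      only {v} m with marked⁻ r (λ _ → false) m
      ... | inj₁ e = e

    redden-sound : ∀ {r M u S R F y F′ y′} → Sound r (config M (u ∷ S) R F y) →
                   Sound r (config M S (suc R) F′ y′)
    redden-sound {u = u} {S} (L , t , us , refl , ch) =
      u ∷ L , t , Unique-resp-↭ (shift u L S) us , refl , ch ∘ ∈-resp-↭ (↭-sym (shift u L S))

    -- The new vertices become children of u, one rank above it, and are childless themselves. Only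
    -- u can lose its childlessness; if nothing new appears it stays a leaf and joins L.
    grow-sound : ∀ {r M u S R F y} y′ → Sound r (config M (u ∷ S) R F y) → Sound r (grow M u S R y′)
    grow-sound {r} {M} {u} {S} {R} y′ (L , t , us , refl , ch) = subst (Sound r) (sym (grown≡ y′)) (sound new refl)
      where
      open Grown (grown M u S R)
      open Parents t

      uM : T (M u)
      uM = proj₁ (ch (∈-++⁺ʳ L (here refl)))

      par′ : Fin n → Fin n
      par′ w with _∈?_ _≟_ w new
      ... | yes _ = u
      ... | no  _ = par w

      rank′ : Fin n → ℕ
      rank′ w with _∈?_ _≟_ w new
      ... | yes _ = suc (rank u)
      ... | no  _ = rank w

      rank-old : ∀ {w} → T (M w) → rank′ w ≡ rank w
      rank-old {w} m with _∈?_ _≟_ w new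
      ... | yes w∈ = contradiction m (unseen w∈)
      ... | no  _  = refl

      old : ∀ {w} → T (M′ w) → w ∉ new → T (M w)
      old m w∉ with mark⁻ _ m
      ... | inj₁ w∈ = contradiction w∈ w∉
      ... | inj₂ m′ = m′

      extended : Parents r M′
      extended = record
        { par = par′ ; rank = rank′ ; root = mark⁺ (inj₂ root)
        ; par∈ = par∈′ ; par-arc = par-arc′ ; rank< = rank<′ }
        where
        par∈′ : ∀ {v} → T (M′ v) → v ≢ r → T (M′ (par′ v))
        par∈′ {v} m v≢r with _∈?_ _≟_ v new
        ... | yes _  = mark⁺ (inj₂ uM)
        ... | no  v∉ = mark⁺ (inj₂ (par∈ (old m v∉) v≢r))
        par-arc′ : ∀ {v} → T (M′ v) → v ≢ r → Arc (par′ v) v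
        par-arc′ {v} m v≢r with _∈?_ _≟_ v new
        ... | yes v∈ = arcs v∈
        ... | no  v∉ = par-arc (old m v∉) v≢r
        rank<′ : ∀ {v} → T (M′ v) → v ≢ r → rank′ (par′ v) < rank′ v
        rank<′ {v} m v≢r with _∈?_ _≟_ v new
        ... | yes _  = s≤s (≤-reflexive (rank-old uM))
        ... | no  v∉ = subst (_< rank v) (sym (rank-old (par∈ (old m v∉) v≢r))) (rank< (old m v∉) v≢r)

      childless : ∀ {v} → T (M v) × Childless v → v ≢ u ⊎ new ≡ [] → Parents.Childless extended v
      childless {v} (mv , c) ok w m w≢r e with _∈?_ _≟_ w new
      childless {v} (mv , c) (inj₁ v≢u) w m w≢r e | yes w∈ = v≢u (sym e)
      childless {v} (mv , c) (inj₂ eq) w m w≢r e | yes w∈ with () ← subst (w ∈_) eq w∈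
      ... | no  w∉ = c w (old m w∉) w≢r e

      childless-new : ∀ {v} → v ∈ new → Parents.Childless extended v
      childless-new {v} v∈ w m w≢r e with _∈?_ _≟_ w new
      ... | yes w∈ = unseen v∈ (subst (T ∘ M) e uM)
      ... | no  w∉ = unseen v∈ (subst (T ∘ M) e (par∈ (old m w∉) w≢r))

      perm : u ∷ L ++ S ↭ L ++ u ∷ S
      perm = ↭-sym (shift u L S)

      us′ : Unique (u ∷ L ++ S)
      us′ = Unique-resp-↭ (↭-sym perm) us

      sound : ∀ N → N ≡ new → Sound r (config M′ (N ++ S) (if length N ≡ᵇ 0 then suc R else R) (length N ≡ᵇ 1) y′)
      sound [] eq = u ∷ L , extended , us′ , refl
        , λ v∈ → let c = ch (∈-resp-↭ perm v∈) in mark⁺ (inj₂ (proj₁ c)) , childless c (inj₂ (sym eq))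
      sound N@(_ ∷ _) eq = L , extended
        , Unique-resp-↭ (shifts N L)
            (Unique.++⁺ (subst Unique (sym eq) unique) (AllPairs.tail us′)
              (λ (p , q) → unseen (is-new p) (proj₁ (ch (∈-resp-↭ perm (there q))))))
        , refl
        , λ v∈ → [ (λ p → mark⁺ (inj₁ (is-new p)) , childless-new (is-new p))
                 , (λ p → let c = ch (∈-resp-↭ perm (there p)) in
                     mark⁺ (inj₂ (proj₁ c)) ,
                     childless c (inj₁ (λ v≡u → All.lookup (AllPairs.head us′) p (sym v≡u)))) ]′
                 (∈-++⁻ N (∈-resp-↭ (shifts L N) v∈))
        where
        is-new : ∀ {v} → v ∈ N → v ∈ new
        is-new = subst (_ ∈_) eq

    step-sound : ∀ {r} c → Sound r c → Sound r (step c)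
    step-sound (config M [] R F y) s = s
    step-sound (config M (u ∷ S) R true y) s = grow-sound {F = true} {y = y} y s
    step-sound (config M (u ∷ S) R false y) s with P ≤ᵇ y + y
    ... | true  = grow-sound {F = false} {y = y} (y + y ∸ P) s
    ... | false = redden-sound {F = false} {y = y} {false} {y + y} s

    run-sound : ∀ {r} i c → Sound r c → Sound r (run i c)
    run-sound zero    c s = s
    run-sound (suc i) c s = run-sound i (step c) (step-sound c s)

    outcome-sound : ∀ r y {k} → k ≤ outcome r y → HasOutTreeWithLeaves D k
    outcome-sound r y k≤ with run n (start r y) | run-sound n (start r y) (start-sound r y)
    ... | config _ _ _ _ _ | L , t , us , refl , ch =
      parents⇒outTree t (++-uniqueˡ L us) k≤ (ch ∘ ∈-++⁺ˡ)

-- Out-trees are found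

x∉p-x : ∀ {n} (p : Subset n) x → x Subset.∉ p Subset.- x
x∉p-x (_ ∷ p) Fin.zero    ()
x∉p-x (_ ∷ p) (Fin.suc x) (there x∈) = x∉p-x p x x∈

bit : Bool → ℕ
bit b = if b then 1 else 0

-- Runs that follow a set of inner vertices

module _ {n : ℕ} (D : Digraph n) where
  open Digraph D

  data Reach (I : Fin n → Set) (r : Fin n) : Fin n → Set where
    source : Reach I r r
    extend : ∀ {u v} → Reach I r u → I u → Arc u v → Reach I r v

  Reach-mono : ∀ {I J r v} → (∀ {u} → I u → J u) → Reach I r v → Reach J r v
  Reach-mono f source         = source
  Reach-mono f (extend ρ i a) = extend (Reach-mono f ρ) (f i) a

  -- Some out-tree rooted at r with at least k leaves has all its inner vertices in I.
  Inner : Subset n → Fin n → ℕ → Set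
  Inner I r k = ∃[ ls ] Unique ls × k ≤ length ls ×
    (∀ {v} → v ∈ ls → Reach (Subset._∈ I) r v × v Subset.∉ I)

  module Follow (P : ℕ) where
    open Search D P

    -- Q lists the vertices already taken off the stack, so the tree consists of Q and the pending
    -- vertices S.
    record Consistent (M : Fin n → Bool) (S Q : List (Fin n)) : Set where
      field
        unique : Unique (Q ++ S)
        mark⁻  : ∀ {v} → T (M v) → v ∈ Q ++ S
        mark⁺  : ∀ {v} → v ∈ Q ++ S → T (M v)

    pop-↭ : ∀ (u : Fin n) S Q → Q ++ u ∷ S ↭ u ∷ Q ++ S
    pop-↭ u S Q = shift u Q S

    pop-consistent : ∀ {M u S Q} → Consistent M (u ∷ S) Q → Consistent M S (u ∷ Q)
    pop-consistent {M} {u} {S} {Q} c = record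
      { unique = Unique-resp-↭ (pop-↭ u S Q) unique
      ; mark⁻  = ∈-resp-↭ (pop-↭ u S Q) ∘ mark⁻
      ; mark⁺  = mark⁺ ∘ ∈-resp-↭ (↭-sym (pop-↭ u S Q))
      }
      where open Consistent c

    push-consistent : ∀ {M u S R Q} (g : Grown M u S R) → Consistent M S Q →
                      Consistent (Grown.M′ g) (Grown.new g ++ S) Q
    push-consistent {S = S} {Q = Q} g c = record
      { unique = Unique-resp-↭ (shifts G.new Q) (Unique.++⁺ G.unique unique (λ (p , q) → G.unseen p (mark⁺ q)))
      ; mark⁻  = λ m → ∈-resp-↭ (shifts G.new Q) ([ ∈-++⁺ˡ , ∈-++⁺ʳ G.new ∘ mark⁻ ]′ (G.mark⁻ _ m))
      ; mark⁺  = λ v∈ → G.mark⁺ (Sum.map₂ mark⁺ (∈-++⁻ G.new (∈-resp-↭ (shifts Q G.new) v∈)))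
      }
      where open Consistent c
            module G = Grown g

    start-consistent : ∀ r → Consistent (marked r (λ _ → false)) [ r ] []
    start-consistent r = record
      { unique = [] ∷ []
      ; mark⁻ = λ m → [ here , (λ ()) ]′ (marked⁻ r (λ _ → false) m)
      ; mark⁺ = λ { (here e) → marked⁺ r (λ _ → false) (inj₁ e) } }

    -- The vertices of Q together with u are distinct, so fewer than n have been processed as long
    -- as one is pending.
    no-fuel : ∀ {M u S Q} → Consistent M (u ∷ S) Q → length Q ≢ n
    no-fuel {M} {u} {S} {Q} c e = <⇒≱ (≤-trans (s≤s (≤-trans (m≤m+n _ _) (≤-reflexive (sym (length-++ Q)))))
      (unique⇒length≤n (Consistent.unique (pop-consistent c)))) (≤-reflexive (sym e))

    run-empty : ∀ i {M R F y} → Config.red (run i (config M [] R F y)) ≡ R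
    run-empty zero    = refl
    run-empty (suc i) = run-empty i

    gain : ∀ R s c → R + suc s ≤ (if c ≡ᵇ 0 then suc R else R) + (c + s)
    gain R s zero    = ≤-reflexive (+-suc R s)
    gain R s (suc c) = +-monoʳ-≤ R (s≤s (m≤n+m s c))

    -- Whatever the remaining guesses are, no step lowers red plus pending: an expanded vertex is
    -- replaced by its new children or by one red vertex. The fuel equation guarantees that the
    -- stack is empty at the end, when all of these are red.
    red-grows : ∀ i {M} S {R F y Q} → Consistent M S Q → i + length Q ≡ n →
                R + length S ≤ Config.red (run i (config M S R F y))
    red-grows i       []      {R} c fuel = ≤-reflexive (trans (+-identityʳ R) (sym (run-empty i)))
    red-grows zero    (u ∷ S) c fuel = contradiction fuel (no-fuel c)
    red-grows (suc i) {M} (u ∷ S) {R} {F} {y} {Q} c fuel = by-choice F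
      where
      fuel′ : i + length (u ∷ Q) ≡ n
      fuel′ = trans (+-suc i _) fuel
      expand : ∀ z → R + suc (length S) ≤ Config.red (run i (grow M u S R z))
      expand z rewrite Grown.grown≡ (grown M u S R) z =
        ≤-trans (≤-trans (gain R (length S) (length new))
                   (+-monoʳ-≤ (if length new ≡ᵇ 0 then suc R else R) (≤-reflexive (sym (length-++ new)))))
                (red-grows i (new ++ S) (push-consistent g (pop-consistent c)) fuel′)
        where g = grown M u S R
              open Grown g
      by-choice : ∀ F → R + suc (length S) ≤ Config.red (run (suc i) (config M (u ∷ S) R F y))
      by-choice true = expand y
      by-choice false with P ≤ᵇ y + y
      ... | true  = expand (y + y ∸ P)
      ... | false = ≤-trans (≤-reflexive (+-suc R _)) (red-grows i S (pop-consistent c) fuel′)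

    module _ (I : Subset n) (r : Fin n) (k : ℕ)
             (inner : Inner I r k)
             (minimal : ∀ {u} → u Subset.∈ I → ¬ Inner (I Subset.- u) r k) where

      outside? : ∀ v → Dec (v Subset.∉ I)
      outside? v = ¬? (Subset._∈?_ v I)

      -- The invariant of a run that expands exactly the vertices of I. Walks in `reached` use only
      -- processed vertices, which `only-child` exploits. In `red≥` there is only an inequality,
      -- because a vertex of I without new out-neighbours becomes red too.
      record Follows (M : Fin n → Bool) (S : List (Fin n)) (R : ℕ) (F : Bool) (Q : List (Fin n)) : Set where
        field
          consistent : Consistent M S Q
          reached    : ∀ {v} → v ∈ Q ++ S → Reach (λ w → w Subset.∈ I × w ∈ Q) r v
          closed     : ∀ {u v} → u ∈ Q → u Subset.∈ I → Arc u v → v ∈ Q ++ S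
          root       : r ∈ Q ++ S
          red≥       : length (filter outside? Q) ≤ R
          forced     : F ≡ true → ∀ {u S′} → S ≡ u ∷ S′ → u Subset.∈ I

      start-follows : Follows (marked r (λ _ → false)) [ r ] 0 false []
      start-follows = record
        { consistent = start-consistent r
        ; reached = λ { (here refl) → source }
        ; closed = λ ()
        ; root = here refl
        ; red≥ = z≤n
        ; forced = λ () }

      -- With nothing pending, `closed` puts every vertex reachable through I into Q; the leaves
      -- promised by `inner` are among the processed vertices outside I, all of which are red.
      finish : ∀ {M R F Q} → Follows M [] R F Q → k ≤ R
      finish {Q = Q} f = let ls , us , k≤ , good = inner in
        ≤-trans k≤ (≤-trans (unique-⊆⇒length≤ us (λ v∈ → let ρ , v∉ = good v∈ in
          ∈-filter⁺ outside? (subst (_ ∈_) (++-identityʳ Q) (visited ρ)) v∉)) red≥)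
        where
        open Follows f
        visited : ∀ {v} → Reach (Subset._∈ I) r v → v ∈ Q ++ []
        visited source         = root
        visited (extend ρ i a) = closed (subst (_ ∈_) (++-identityʳ Q) (visited ρ)) i a

      redden : ∀ {M u S R F Q} → Follows M (u ∷ S) R F Q → u Subset.∉ I → Follows M S (suc R) false (u ∷ Q)
      redden {M} {u} {S} {R} {F} {Q} f u∉ = record
        { consistent = pop-consistent consistent
        ; reached = λ v∈ → Reach-mono (λ (i , q) → i , there q) (reached (∈-resp-↭ (↭-sym (pop-↭ u S Q)) v∈))
        ; closed = λ { (here refl) i _ → contradiction i u∉
                     ; (there x∈) i a → ∈-resp-↭ (pop-↭ u S Q) (closed x∈ i a) }
        ; root = ∈-resp-↭ (pop-↭ u S Q) root
        ; red≥ = ≤-trans (≤-reflexive (cong length (filter-accept outside? u∉))) (s≤s red≥)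
        ; forced = λ () }
        where open Follows f

      -- If the only new out-neighbour w of u were outside I, then u could replace w as a leaf
      -- and I would not be minimal.
      only-child : ∀ {M u S R F Q} → Follows M (u ∷ S) R F Q → u Subset.∈ I →
                   ∀ {w} → Grown.new (grown M u S R) ≡ [ w ] → w Subset.∈ I
      only-child {M} {u} {S} {R} {F} {Q} f u∈ {w} eq with Subset._∈?_ w I
      ... | yes w∈ = w∈
      ... | no  w∉ = ⊥-elim (minimal u∈ (let ls , us , k≤ , good = inner in exchange us k≤ good))
        where
        open Follows f
        module C = Consistent consistent
        module G = Grown (grown M u S R)

        -- The walks supplied by `reached` run through Q, and u is not yet in Q.
        early : ∀ {v} → v ∈ Q ++ u ∷ S → Reach (Subset._∈ (I Subset.- u)) r v
        early v∈ = Reach-mono (λ (i , q) → Subset.x∈p∧x≢y⇒x∈p-y i (λ { refl →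
          All.lookup (AllPairs.head (Unique-resp-↭ (pop-↭ u S Q) C.unique)) (∈-++⁺ˡ q) refl })) (reached v∈)

        -- A walk leaving u goes to w, where it must stop as w is outside I, or to a vertex of the
        -- old tree, which `early` reaches without u.
        avoid : ∀ {v} → Reach (Subset._∈ I) r v → v ≡ w ⊎ Reach (Subset._∈ (I Subset.- u)) r v
        avoid source = inj₂ source
        avoid (extend {x} ρ x∈ a) with avoid ρ | x ≟ u
        ... | inj₁ refl | _      = contradiction x∈ w∉
        ... | inj₂ ρ′   | no x≢u = inj₂ (extend ρ′ (Subset.x∈p∧x≢y⇒x∈p-y x∈ x≢u) a)
        ... | inj₂ _    | yes refl with G.mark⁻ _ (G.complete a)
        ...   | inj₂ m  = inj₂ (early (C.mark⁻ m))
        ...   | inj₁ v∈ with subst (_ ∈_) eq v∈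
        ...     | here v≡w = inj₁ v≡w

        exchange : ∀ {ls} → Unique ls → k ≤ length ls →
                   (∀ {v} → v ∈ ls → Reach (Subset._∈ I) r v × v Subset.∉ I) → Inner (I Subset.- u) r k
        exchange {ls} us k≤ good = u ∷ ls′ , unique′ , ≤-trans k≤ longer , good′
          where
          other? : ∀ v → Dec (v ≢ w)
          other? v = ¬? (v ≟ w)
          ls′ : List (Fin n)
          ls′ = filter other? ls
          unique′ : Unique (u ∷ ls′)
          unique′ = All.tabulate (λ v∈ u≡v → proj₂ (good (proj₁ (∈-filter⁻ other? v∈))) (subst (Subset._∈ I) u≡v u∈))
                    ∷ Unique.filter⁺ other? us
          longer : length ls ≤ suc (length ls′)
          longer = unique-⊆⇒length≤ {ys = w ∷ ls′} us sub
            where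
            sub : ∀ {v} → v ∈ ls → v ∈ w ∷ ls′
            sub {v} v∈ with v ≟ w
            ... | yes v≡w = here v≡w
            ... | no  v≢w = there (∈-filter⁺ other? v∈ v≢w)
          good′ : ∀ {v} → v ∈ u ∷ ls′ → Reach (Subset._∈ (I Subset.- u)) r v × v Subset.∉ I Subset.- u
          good′ (here refl) = early (∈-++⁺ʳ Q (here refl)) , x∉p-x I u
          good′ (there v∈) with ∈-filter⁻ other? v∈
          ... | v∈ls , v≢w with avoid (proj₁ (good v∈ls))
          ...   | inj₁ v≡w = contradiction v≡w v≢w
          ...   | inj₂ ρ   = ρ , proj₂ (good v∈ls) ∘ Subset.p─q⊆p I Subset.⁅ u ⁆

      expand : ∀ {M u S R F Q} → Follows M (u ∷ S) R F Q → u Subset.∈ I →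
               let open Grown (grown M u S R) in
               Follows M′ (new ++ S) (if length new ≡ᵇ 0 then suc R else R) (length new ≡ᵇ 1) (u ∷ Q)
      expand {M} {u} {S} {R} {F} {Q} f u∈ = record
        { consistent = C′
        ; reached = λ v∈ → [ (λ p → extend (Reach-mono weaken (reached u∈Q++u∷S)) (u∈ , here refl) (G.arcs p))
                           , (λ q → Reach-mono weaken (reached (∈-resp-↭ (↭-sym (pop-↭ u S Q)) q))) ]′
                           (∈-++⁻ G.new (∈-resp-↭ (shifts (u ∷ Q) G.new) v∈))
        ; closed = λ { (here refl) _ a → Consistent.mark⁻ C′ (G.complete a)
                     ; (there x∈) i a → keep (closed x∈ i a) }
        ; root = keep root
        ; red≥ = ≤-trans (≤-reflexive (cong length (filter-reject outside? (λ u∉ → u∉ u∈))))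
                   (≤-trans red≥ (R≤ (length G.new)))
        ; forced = λ e → forced′ G.new refl e
        }
        where
        open Follows f
        module G = Grown (grown M u S R)
        C′ : Consistent G.M′ (G.new ++ S) (u ∷ Q)
        C′ = push-consistent (grown M u S R) (pop-consistent consistent)
        weaken : ∀ {w} → w Subset.∈ I × w ∈ Q → w Subset.∈ I × w ∈ u ∷ Q
        weaken (i , q) = i , there q
        u∈Q++u∷S : u ∈ Q ++ u ∷ S
        u∈Q++u∷S = ∈-++⁺ʳ Q (here refl)
        keep : ∀ {v} → v ∈ Q ++ u ∷ S → v ∈ u ∷ Q ++ G.new ++ S
        keep v∈ = ∈-resp-↭ (shifts G.new (u ∷ Q)) (∈-++⁺ʳ G.new (∈-resp-↭ (pop-↭ u S Q) v∈))
        R≤ : ∀ c → R ≤ (if c ≡ᵇ 0 then suc R else R)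
        R≤ zero    = n≤1+n R
        R≤ (suc c) = ≤-refl
        -- A decision is forced only by a single new vertex, and `only-child` places that vertex in
        -- I.
        forced′ : ∀ N → G.new ≡ N → (length N ≡ᵇ 1) ≡ true → ∀ {v S′} → N ++ S ≡ v ∷ S′ → v Subset.∈ I
        forced′ (w ∷ []) eq _ refl = only-child f u∈ eq

      draw-0 : ∀ {M u S R} y → y + y < P → step (config M (u ∷ S) R false y) ≡ config M S (suc R) false (y + y)
      draw-0 y lt with P ≤ᵇ y + y in e
      ... | false = refl
      ... | true  = contradiction (≤ᵇ⇒≤ P (y + y) (subst T (sym e) tt)) (<⇒≱ lt)

      draw-1 : ∀ {M u S R} y {z} → y + y ≡ z + P → step (config M (u ∷ S) R false y) ≡ grow M u S R z
      draw-1 {M} {u} {S} {R} y {z} e with P ≤ᵇ y + y in le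
      ... | true  = cong (grow M u S R) (trans (cong (_∸ P) e) (m+n∸n≡m z P))
      ... | false = ⊥-elim (subst T le (≤⇒≤ᵇ (≤-trans (m≤n+m P z) (≤-reflexive (sym e)))))

      potential : ℕ → ℕ → Bool → ℕ
      potential R s F = R + R + s + bit F

      -- The flag on the left is `true` also when an unforced expansion is treated: the additional 1
      -- is the increase that pays for the digit just read.
      gain₂ : ∀ R (S new : List (Fin n)) → potential R (suc (length S)) true ≤
              potential (if length new ≡ᵇ 0 then suc R else R) (length (new ++ S)) (length new ≡ᵇ 1)
      gain₂ R S []            = ≤-reflexive (solve 2 (λ R s → R :+ R :+ (con 1 :+ s) :+ con 1 :=
                                  (con 1 :+ R) :+ (con 1 :+ R) :+ s :+ con 0) refl R (length S))
        where open +-*-Solver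
      gain₂ R S (_ ∷ [])      = ≤-refl
      gain₂ R S (_ ∷ _ ∷ new) = ≤-trans
        (≤-reflexive (trans (+-comm (R + R + suc (length S)) 1) (sym (+-suc (R + R) (suc (length S))))))
        (≤-trans (+-monoʳ-≤ (R + R) (s≤s (s≤s
                   (≤-trans (m≤n+m (length S) (length new)) (≤-reflexive (sym (length-++ new)))))))
                 (≤-reflexive (sym (+-identityʳ _))))

      -- Twice red plus pending is at most 2 (R + s), and the flag adds at most 1, so a potential
      -- above 2k needs R + s ≥ k.
      enough : ∀ R s F → suc (k + k) ≤ potential R s F → k ≤ R + s
      enough R s F le with k ≤? R + s
      ... | yes k≤ = k≤
      ... | no  k≰ = contradiction le (<⇒≱ (s≤s (≤-trans (+-monoʳ-≤ (R + R + s) (bit≤1 F)) bound)))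
        where
        bit≤1 : ∀ F → bit F ≤ 1
        bit≤1 true  = ≤-refl
        bit≤1 false = z≤n
        bound : R + R + s + 1 ≤ k + k
        bound = ≤-trans (≤-reflexive (trans (+-assoc (R + R) s 1) (+-assoc R R (s + 1))))
          (≤-trans (+-monoʳ-≤ R (≤-reflexive (trans (sym (+-assoc R s 1)) (+-comm (R + s) 1))))
            (+-mono-≤ (≤-trans (m≤m+n R s) (<⇒≤ (≰⇒> k≰))) (≰⇒> k≰)))

      -- The choices are found backwards: if z continues the search after one more guess b,
      -- then y with 2 y = z + b P starts with that guess.
      guess : ∀ i j M S R F Q q → Follows M S R F Q → i + length Q ≡ n → q * 2 ^ j ≡ P → 0 < P →
              suc (k + k) ≤ potential R (length S) F + j →
              ∃[ m ] m * q < P × k ≤ Config.red (run i (config M S R F (m * q)))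
      -- No digits are left, but the potential already guarantees k leaves and `red-grows` keeps
      -- them under any choice, so 0 will do.
      guess i zero M S R F Q q f fuel eq P>0 pot =
        0 , P>0 , ≤-trans (enough R (length S) F (subst (suc (k + k) ≤_) (+-identityʳ _) pot))
                          (red-grows i S (Follows.consistent f) fuel)
      guess i (suc j) M [] R F Q q f fuel eq P>0 pot =
        0 , P>0 , ≤-trans (finish f) (≤-reflexive (sym (run-empty i)))
      guess zero (suc j) M (u ∷ S) R F Q q f fuel eq P>0 pot =
        contradiction fuel (no-fuel (Follows.consistent f))
      guess (suc i) (suc j) M (u ∷ S) R true Q q f fuel eq P>0 pot =
        let m , lt , k≤ = guess i (suc j) M′ (new ++ S) _ _ (u ∷ Q) q (expand f (Follows.forced f refl refl))
              (trans (+-suc i _) fuel) eq P>0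
              (≤-trans pot (+-monoˡ-≤ (suc j) (gain₂ R S new)))
        in m , lt , ≤-trans k≤ (≤-reflexive (cong (Config.red ∘ run i) (sym (grown≡ (m * q)))))
        where open Grown (grown M u S R)
      guess (suc i) (suc j) M (u ∷ S) R false Q q f fuel eq P>0 pot with Subset._∈?_ u I
      -- Digit 0: doubling m q gives m (q + q), the choice found for the rest of the run. The unit q
      -- doubles as j drops.
      ... | no u∉ =
        let m , lt , k≤ = guess i j M S (suc R) false (u ∷ Q) (q + q) (redden f u∉) (trans (+-suc i _) fuel) eq′ P>0
              (≤-trans pot (≤-reflexive (solve 3 (λ R s j → R :+ R :+ (con 1 :+ s) :+ con 0 :+ (con 1 :+ j) :=
                 (con 1 :+ R) :+ (con 1 :+ R) :+ s :+ con 0 :+ j) refl R (length S) j)))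
            d = sym (*-distribˡ-+ m q q)
        in m , ≤-<-trans (*-monoʳ-≤ m (m≤m+n q q)) lt
             , ≤-trans k≤ (≤-reflexive (cong (Config.red ∘ run i)
                 (sym (trans (draw-0 (m * q) (≤-<-trans (≤-reflexive d) lt)) (cong (config M S (suc R) false) d)))))
        where
        open +-*-Solver
        eq′ : (q + q) * 2 ^ j ≡ P
        eq′ = trans (solve 2 (λ q p → (q :+ q) :* p := q :* (p :+ (p :+ con 0))) refl q (2 ^ j)) eq
      ... | yes u∈ =
        let m , lt , k≤ = guess i j M′ (new ++ S) _ _ (u ∷ Q) (q + q) (expand f u∈) (trans (+-suc i _) fuel) eq′ P>0
              (≤-trans pot (≤-trans (≤-reflexive shift-one) (+-monoˡ-≤ j (gain₂ R S new))))
            d : (m + 2 ^ j) * q + (m + 2 ^ j) * q ≡ m * (q + q) + P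
            d = trans (solve 3 (λ m p q → (m :+ p) :* q :+ (m :+ p) :* q := m :* (q :+ q) :+ (q :+ q) :* p)
                         refl m (2 ^ j) q)
                      (cong (m * (q + q) +_) eq′)
        -- Digit 1: the summand 2 ^ j in units of q is half of P, so doubling produces exactly the P
        -- that `draw-1` removes.
        in m + 2 ^ j
           , half-< (≤-<-trans (≤-reflexive d) (+-monoˡ-< P lt))
           , ≤-trans k≤ (≤-reflexive (cong (Config.red ∘ run i)
               (sym (trans (draw-1 ((m + 2 ^ j) * q) d) (grown≡ (m * (q + q)))))))
        where
        open +-*-Solver
        open Grown (grown M u S R)
        eq′ : (q + q) * 2 ^ j ≡ P
        eq′ = trans (solve 2 (λ q p → (q :+ q) :* p := q :* (p :+ (p :+ con 0))) refl q (2 ^ j)) eq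
        shift-one : potential R (suc (length S)) false + suc j ≡ potential R (suc (length S)) true + j
        shift-one = solve 3 (λ R s j → R :+ R :+ (con 1 :+ s) :+ con 0 :+ (con 1 :+ j) :=
                      R :+ R :+ (con 1 :+ s) :+ con 1 :+ j) refl R (length S) j
        half-< : ∀ {a} → a + a < P + P → a < P
        half-< {a} lt = ≰⇒> (λ P≤a → <⇒≱ lt (+-mono-≤ P≤a P≤a))

    -- Infinite descent on the size of I: if a vertex could be dropped, the smaller set would
    -- already contradict the rejections. As the goal is absurdity, I may thus be taken minimal
    -- without searching for a minimal set.
    outcome-complete : ∀ i {I r k} → P ≡ 2 ^ (k + k) → ∣ I ∣ ≤ i → Inner I r k →
                       (∀ y → y < P → outcome r y < k) → ⊥
    outcome-complete i {I} {r} {k} P≡ size inner reject =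
      -- The pending root gives potential 1; with q = 1 and j = 2k the required `suc (k + k)` is met
      -- exactly.
      let m , lt , k≤ = guess I r k inner (minimal i size) n (k + k) _ [ r ] 0 false [] 1
                          (start-follows I r k inner (minimal i size)) (+-identityʳ n)
                          (trans (+-identityʳ _) (sym P≡)) (subst (0 <_) (sym P≡) (m^n>0 2 (k + k))) ≤-refl
      in <⇒≱ (reject (m * 1) lt) k≤
      where
      minimal : ∀ i → ∣ I ∣ ≤ i → ∀ {u} → u Subset.∈ I → ¬ Inner (I Subset.- u) r k
      minimal zero    size u∈ _ = n≮0 (≤-trans (Subset.x∈p⇒∣p-x∣<∣p∣ u∈) size)
      minimal (suc i) size u∈ inner′ =
        outcome-complete i P≡ (≤-pred (≤-trans (Subset.x∈p⇒∣p-x∣<∣p∣ u∈) size)) inner′ reject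

-- The inner vertices of an out-tree

members : ∀ {n} (p : Subset n) →
          ∃[ xs ] Unique xs × length xs ≡ ∣ p ∣ × (∀ {x} → x ∈ xs → x Subset.∈ p)
members [] = [] , [] , refl , λ ()
members (b ∷ p) with members p
... | xs , us , len , sub = consider b
  where
  sub′ : ∀ {b x} → x ∈ map Fin.suc xs → x Subset.∈ b ∷ p
  sub′ x∈ with ∈-map⁻ Fin.suc x∈
  ... | y , y∈ , refl = there (sub y∈)
  consider : ∀ b → ∃[ ys ] Unique ys × length ys ≡ ∣ b ∷ p ∣ × (∀ {y} → y ∈ ys → y Subset.∈ b ∷ p)
  consider false = map Fin.suc xs , Unique.map⁺ suc-injective us , trans (length-map Fin.suc xs) len , sub′
  consider true  = Fin.zero ∷ map Fin.suc xs
    , All.tabulate (λ y∈ e → let _ , _ , e′ = ∈-map⁻ Fin.suc y∈ in contradiction (trans e e′) λ ())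
      ∷ Unique.map⁺ suc-injective us
    , cong suc (trans (length-map Fin.suc xs) len)
    , λ { (here refl) → here ; (there y∈) → sub′ y∈ }

linked-cut : ∀ {A : Set} {R : A → A → Set} xs {z ys} → Linked R (xs ++ z ∷ ys) → Linked R (xs ++ [ z ])
linked-cut []           _       = [-]
linked-cut (x ∷ [])     (r ∷ _) = r ∷ [-]
linked-cut (x ∷ y ∷ xs) (r ∷ l) = r ∷ linked-cut (y ∷ xs) l

module _ {n : ℕ} (D : Digraph n) where

  module OutTree {S : Subdigraph D} (isOutTree : IsOutTree S) where
    open Subdigraph S
    open IsOutTree isOutTree
    open IsOrientedTree orientedTree

    root : Fin n
    root = proj₁ uniqueRoot

    inner : Subset n
    inner = tabulate (λ v → not (outDegree v ≡ᵇ 0))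

    tail-inner : ∀ {u v} → Arc u v → u Subset.∈ inner
    tail-inner {u} {v} a = ∈-tabulate⁺ {f = λ v → not (outDegree v ≡ᵇ 0)} (nonzero (outDegree u) refl)
      where
      nonzero : ∀ d → outDegree u ≡ d → T (not (d ≡ᵇ 0))
      nonzero zero    e = ∣tabulate∣≡0⁻ e v a
      nonzero (suc d) e = _

    -- A return to z closes a cycle of length one, two or at least three, excluded by looplessness,
    -- `oriented` and `cycleFree` respectively.
    no-return : ∀ z pre {post} → Linked Arc (z ∷ pre ++ z ∷ post) → ¬ Unique (pre ++ z ∷ post)
    no-return z []            (a ∷ _) us = Digraph.loopless D z (arc-in-D a)
    no-return z (w ∷ [])      (a ∷ b ∷ _) us = oriented a b
    no-return z (x ∷ y ∷ pre) {post} l us = cycleFree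
      ( z , x ∷ y ∷ pre , s≤s (s≤s (s≤s z≤n))
      , ++-uniqueˡ (z ∷ x ∷ y ∷ pre) (Unique-resp-↭ (shift z (x ∷ y ∷ pre) post) us)
      , Linked.map fwd (linked-cut (z ∷ x ∷ y ∷ pre) l))

    -- Walking backwards along arcs never repeats a vertex, hence ends in the root.
    reach : ∀ i w ws → i + length (w ∷ ws) ≡ suc n → Unique (w ∷ ws) → Linked Arc (w ∷ ws) →
            w Subset.∈ vertices → Reach D (Subset._∈ inner) root w
    -- Here the list would contain n + 1 distinct vertices.
    reach zero    w ws len us l w∈ = contradiction (unique⇒length≤n us) (<⇒≱ (≤-reflexive (sym len)))
    reach (suc i) w ws len us l w∈ with any? (λ z → T? (arc z w))
    ... | no  none = subst (Reach D _ root)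
                       (proj₂ (proj₂ uniqueRoot) (w∈ , ∣tabulate∣≡0⁺ (λ z a → none (z , a)))) source
    ... | yes (z , a) with _∈?_ _≟_ z (w ∷ ws)
    ...   | no  z∉ = extend (reach i z (w ∷ ws) (trans (+-suc i _) len) (¬Any⇒All¬ _ z∉ ∷ us) (a ∷ l) (tail∈ a))
                            (tail-inner a) (arc-in-D a)
    ...   | yes z∈ with ∈-∃++ z∈
    ...     | pre , post , e = ⊥-elim (no-return z pre (subst (Linked Arc ∘ (z ∷_)) e (a ∷ l)) (subst Unique e us))

    reached : ∀ {v} → v Subset.∈ vertices → Reach D (Subset._∈ inner) root v
    reached {v} = reach n v [] (+-comm n 1) ([] ∷ []) [-]

    innerVertices : ∀ {k} → k ≤ ∣ leaves ∣ → Inner D inner root k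
    innerVertices k≤ with members leaves
    ... | ls , us , len , sub = ls , us , ≤-trans k≤ (≤-reflexive (sym len)) , λ v∈ → good (∈-tabulate⁻ (sub v∈))
      where
      good : ∀ {v} → T (lookup vertices v ∧ (outDegree v ≡ᵇ 0)) → Reach D (Subset._∈ inner) root v × v Subset.∉ inner
      good {v} t with Equivalence.to T-∧ t
      ... | v∈ , d≡0 = reached (lookup⇒[]= v vertices (Equivalence.to T-≡ v∈))
          , λ v∈inner → contradiction
              (trans (sym (Equivalence.to T-not-≡ (∈-tabulate⁻ {f = λ v → not (outDegree v ≡ᵇ 0)} v∈inner)))
                     (Equivalence.to T-≡ d≡0)) λ ()

  reject-sound : ∀ {P k} → P ≡ 2 ^ (k + k) → (∀ r y → y < P → Search.outcome D P r y < k) →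
                 ¬ HasOutTreeWithLeaves D k
  reject-sound {P} P≡ reject (S , isOutTree , k≤) =
    Follow.outcome-complete D P ∣ inner ∣ P≡ ≤-refl (innerVertices k≤) (reject root)
    where open OutTree isOutTree

-- The program

-- No program writes nil, which therefore holds 0.
rn rk one rP found rr rx ry sp red forced ru off ri fresh tmp idx iter nil : Reg
rn = 0
rk = 1
one = 2
rP = 3
found = 4
rr = 5
rx = 6
ry = 7
sp = 8
red = 9
forced = 10
ru = 11
off = 12
ri = 13
fresh = 14
tmp = 15
idx = 16
iter = 17
nil = 18

adj marks stk : Array
adj = 0
marks = 1
stk = 2

visitP offsetP scanP settleP growP drawP stepP clearP searchP judgeP powerP tryP mainP : Program
visitP = monus ri ri one ⨾ add idx off ri ⨾ load tmp adj idx ⨾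
  ifnz tmp
    (load tmp marks ri ⨾
     ifnz tmp skip (store marks ri one ⨾ store stk sp ri ⨾ add sp sp one ⨾ add fresh fresh one))
    skip
-- The start of row `ru` in the adjacency matrix, computed by repeated addition; adding `nil` copies
-- a register.
offsetP = const off 0 ⨾ add ri ru nil ⨾ while ri (monus ri ri one ⨾ add off off rn)
scanP = const fresh 0 ⨾ add ri rn nil ⨾ while ri visitP
settleP = ifnz fresh (monus tmp fresh one ⨾ ifnz tmp skip (const forced 1)) (add red red one)
growP = const forced 0 ⨾ offsetP ⨾ scanP ⨾ settleP
-- After doubling, `tmp` becomes y + 1 ∸ P, which is nonzero exactly when P ≤ y. The same device
-- compares `red` with k in `judgeP`.
drawP = add ry ry ry ⨾ add tmp ry one ⨾ monus tmp tmp rP ⨾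
  ifnz tmp (monus ry ry rP ⨾ growP) (add red red one)
stepP = ifnz sp (monus sp sp one ⨾ load ru stk sp ⨾ ifnz forced growP drawP) skip
clearP = add ri rn nil ⨾ while ri (monus ri ri one ⨾ store marks ri nil)
searchP = clearP ⨾
  store marks rr one ⨾ const sp 0 ⨾ store stk sp rr ⨾ const sp 1 ⨾ const red 0 ⨾ const forced 0 ⨾
  add ry rx nil ⨾ add iter rn nil ⨾ while iter (monus iter iter one ⨾ stepP)
judgeP = add tmp red one ⨾ monus tmp tmp rk ⨾ ifnz tmp (const found 1) skip
powerP = const one 1 ⨾ const rP 1 ⨾ add ri rk rk ⨾ while ri (monus ri ri one ⨾ add rP rP rP)
tryP = monus rr rr one ⨾ add rx rP nil ⨾ while rx (monus rx rx one ⨾ searchP ⨾ judgeP)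
mainP = powerP ⨾ (add rr rn nil ⨾ while rr tryP) ⨾ add rn found nil

-- The program simulates the search

StackOf : ∀ {n} → (ℕ → ℕ) → List (Fin n) → Set
StackOf c []      = ⊤
StackOf c (v ∷ S) = c (length S) ≡ toℕ v × StackOf c S

-- Cells from the stack pointer upwards are unconstrained, so pushing there disturbs nothing and
-- popping may leave old values behind.
stack-frame : ∀ {n c i x} (S : List (Fin n)) → length S ≤ i → StackOf c S → StackOf (c [ i ↦ x ]) S
stack-frame []      _  _          = tt
stack-frame {c = c} {x = x} (v ∷ S) lt (top , st) =
  trans (update-other c x (<⇒≢ lt)) top , stack-frame S (<⇒≤ lt) st

push-stack : ∀ {n c i x} {v : Fin n} {S} → i ≡ length S → x ≡ toℕ v → StackOf c S → StackOf (c [ i ↦ x ]) (v ∷ S)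
push-stack {c = c} {S = S} refl refl st = update-same c _ _ , stack-frame S ≤-refl st

MarksOf : ∀ {n} → (ℕ → ℕ) → (Fin n → Bool) → Set
MarksOf c M = ∀ v → c (toℕ v) ≡ bit (M v)

mark-marks : ∀ {n c i x v} {M : Fin n → Bool} → i ≡ toℕ v → x ≡ 1 → MarksOf c M → MarksOf (c [ i ↦ x ]) (marked v M)
mark-marks {v = v} refl refl m w with toℕ w ≡ᵇ toℕ v
... | true  = refl
... | false = m w

pred-one : ∀ {a b j} → a ≡ suc j → b ≡ 1 → a ∸ b ≡ j
pred-one refl refl = refl

plus-zero : ∀ {a b m} → a ≡ m → b ≡ 0 → a + b ≡ m
plus-zero {a} refl refl = +-identityʳ a

plus-one : ∀ {a b m} → a ≡ m → b ≡ 1 → a + b ≡ suc m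
plus-one {a} refl refl = +-comm a 1

nonzero : ∀ {a m} → a ≡ suc m → a ≢ 0
nonzero refl ()

module Simulation {n : ℕ} (D : Digraph n) (k P : ℕ) where
  open Search D P

  -- The part of the state that stays fixed during the whole search.
  Env : State → Set
  Env s = reg s rn ≡ n × reg s rk ≡ k × reg s one ≡ 1 × reg s rP ≡ P × reg s nil ≡ 0 ×
          cell s adj ≡ adjacencyCells D

  spares : Program → Bool
  spares p = not (writesReg p rn) ∧ not (writesReg p rk) ∧ not (writesReg p one) ∧ not (writesReg p rP) ∧
             not (writesReg p nil) ∧ not (writesArray p adj)

  -- For a concrete program `spares p` evaluates to `true`, so the implicit hypothesis is filled in
  -- automatically.
  env-frame : ∀ {p s s′} {_ : T (spares p)} → Frame p s s′ → Env s → Env s′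
  env-frame {p} {_} {_} {ok} f (a , b , c , d , e , g)
    with ok₁ , ok ← Equivalence.to (T-∧ {not (writesReg p rn)}) ok
    with ok₂ , ok ← Equivalence.to (T-∧ {not (writesReg p rk)}) ok
    with ok₃ , ok ← Equivalence.to (T-∧ {not (writesReg p one)}) ok
    with ok₄ , ok ← Equivalence.to (T-∧ {not (writesReg p rP)}) ok
    with ok₅ , ok₆ ← Equivalence.to (T-∧ {not (writesReg p nil)}) ok =
      trans (regs f rn (false! ok₁)) a , trans (regs f rk (false! ok₂)) b , trans (regs f one (false! ok₃)) c ,
      trans (regs f rP (false! ok₄)) d , trans (regs f nil (false! ok₅)) e , trans (arrays f adj (false! ok₆)) g
    where
    false! : ∀ {b} → T (not b) → b ≡ false
    false! = Equivalence.to T-not-≡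

  RepF : Frontier n → State → Set
  RepF (frontier M S c) s = MarksOf (cell s marks) M × StackOf (cell s stk) S × reg s sp ≡ length S × reg s fresh ≡ c

  Rep : Config n → State → Set
  Rep (config M S R F y) s =
    MarksOf (cell s marks) M × StackOf (cell s stk) S × reg s sp ≡ length S ×
    reg s red ≡ R × reg s forced ≡ bit F × reg s ry ≡ y

  visit-run : ∀ {u j f s} .(j<n : j < n) → Env s → reg s off ≡ n * toℕ u → reg s ri ≡ suc j → RepF f s →
              Run visitP s (λ s′ → reg s′ ri ≡ j × RepF (visit u (fromℕ< j<n) f) s′) 10
  visit-run {u} {j} {f@(frontier M S c)} {s} j<n (_ , _ , one≡ , _ , _ , adj≡) off≡ ri≡ (ms , st , sp≡ , fr≡) =
    monus then add then load then probe
    where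
    v : Fin n
    v = fromℕ< j<n
    i≡j : reg s ri ∸ reg s one ≡ j
    i≡j = pred-one ri≡ one≡
    i≡v : reg s ri ∸ reg s one ≡ toℕ v
    i≡v = trans i≡j (sym (toℕ-fromℕ< j<n))
    entry : cell s adj (reg s off + (reg s ri ∸ reg s one)) ≡ bit (Digraph.arc D u v)
    entry = trans (cong-app adj≡ _) (trans (cong (adjacencyCells D) (cong₂ _+_ off≡ i≡v)) (adjacencyCells-arc D u v))
    mark≡ : cell s marks (reg s ri ∸ reg s one) ≡ bit (M v)
    mark≡ = trans (cong (cell s marks) i≡v) (ms v)
    probe : Run _ _ (λ s′ → reg s′ ri ≡ j × RepF (visit u v f) s′) 7
    probe with Digraph.arc D u v | entry
    ... | false | e = run-if≡0 e (run-weaken (s≤s z≤n) (λ q → q) (now skip (i≡j , ms , st , sp≡ , fr≡)))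
    ... | true  | e with M v | mark≡
    ...   | true  | m = run-if≢0 (nonzero e) (load then run-if≢0 (nonzero m)
                          (run-weaken (s≤s z≤n) (λ q → q) (now skip (i≡j , ms , st , sp≡ , fr≡))))
    ...   | false | m = run-if≢0 (nonzero e) (load then run-if≡0 m
                          (store then store then add then now add
                            ( i≡j , mark-marks {c = cell s marks} {M = M} i≡v one≡ ms , push-stack sp≡ i≡v st
                            , plus-one sp≡ one≡ , plus-one fr≡ one≡ )))

  scan-run : ∀ {u M S s} → Env s → reg s off ≡ n * toℕ u →
             MarksOf (cell s marks) M → StackOf (cell s stk) S → reg s sp ≡ length S →
             Run scanP s (RepF (scan u n ≤-refl (frontier M S 0))) (3 + n * 11)
  scan-run {u} {M} {S} {s} e@(n≡ , _ , _ , _ , nil≡ , _) off≡ ms st sp≡ =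
    const then add then run-weaken ≤-refl (λ { (f , rep , _ , refl) → rep })
      (countdown Inv n body (plus-zero n≡ nil≡)
        (frontier M S 0 , (ms , st , sp≡ , refl) , ≤-refl , refl))
    where
    target = scan u n ≤-refl (frontier M S 0)
    Inv : ℕ → State → Set
    -- The invariant looks ahead: finishing the scan from the current frontier yields `target`. This
    -- avoids describing the part already done; `search-run` treats `run` alike.
    Inv j s = ∃[ f ] RepF f s × ∃[ j≤n ] scan u j j≤n f ≡ target
    body : ∀ {j s₁} → j < n → Frame visitP _ s₁ → reg s₁ ri ≡ suc j → Inv (suc j) s₁ →
           Run visitP s₁ (λ s′ → reg s′ ri ≡ j × Inv j s′) 10
    body {j} {s₁} j<n fr i≡ (f , rep , _ , eq) =
      run-weaken ≤-refl (λ (i≡′ , rep′) → i≡′ , _ , rep′ , <⇒≤ j<n , eq)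
        (visit-run {f = f} {s = s₁} j<n (env-frame fr e) (trans (regs fr off refl) off≡) i≡ rep)

  offset-run : ∀ {m s} → Env s → reg s ru ≡ m → Run offsetP s (λ s′ → reg s′ off ≡ n * m) (3 + m * 3)
  offset-run {m} {s} e@(_ , _ , _ , _ , nil≡ , _) u≡ =
    const then add then run-weaken ≤-refl
      (λ {s′} eq → trans (sym (+-identityʳ _)) (trans (cong (reg s′ off +_) (sym (*-zeroʳ n))) eq))
      (countdown Inv m body (plus-zero u≡ nil≡) refl)
    where
    Inv : ℕ → State → Set
    Inv j s = reg s off + n * j ≡ n * m
    body : ∀ {j s₁} → j < m → Frame (monus ri ri one ⨾ add off off rn) _ s₁ → reg s₁ ri ≡ suc j → Inv (suc j) s₁ →
           Run (monus ri ri one ⨾ add off off rn) s₁ (λ s′ → reg s′ ri ≡ j × Inv j s′) 2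
    body {j} {s₁} _ fr i≡ eq with env-frame fr e
    ... | n≡ , _ , one≡ , _ = monus then now add
      ( pred-one i≡ one≡
      , trans (cong (λ m → reg s₁ off + m + n * j) n≡)
          (trans (+-assoc (reg s₁ off) n (n * j)) (trans (cong (reg s₁ off +_) (sym (*-suc n j))) eq)) )

  settle-run : ∀ {f R y s} → Env s → RepF f s → reg s red ≡ R → reg s forced ≡ 0 → reg s ry ≡ y →
               Run settleP s (Rep (settle R y f)) 4
  settle-run {frontier M S zero} (_ , _ , one≡ , _) (ms , st , sp≡ , fr≡) red≡ forced≡ y≡ =
    run-weaken (s≤s (s≤s z≤n)) (λ q → q) (run-if≡0 fr≡ (now add (ms , st , sp≡ , plus-one red≡ one≡ , forced≡ , y≡)))
  settle-run {frontier M S (suc zero)} (_ , _ , one≡ , _) (ms , st , sp≡ , fr≡) red≡ forced≡ y≡ =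
    run-if≢0 (nonzero fr≡) (monus then run-if≡0 (pred-one fr≡ one≡) (now const (ms , st , sp≡ , red≡ , refl , y≡)))
  settle-run {frontier M S (suc (suc c))} (_ , _ , one≡ , _) (ms , st , sp≡ , fr≡) red≡ forced≡ y≡ =
    run-if≢0 (nonzero fr≡) (monus then run-if≢0 (nonzero (pred-one fr≡ one≡))
      (now skip (ms , st , sp≡ , red≡ , forced≡ , y≡)))

  growTime : ℕ
  growTime = 1 + (3 + n * 3 + (3 + n * 11 + 4))

  grow-run : ∀ {M u S R y s} → Env s → MarksOf (cell s marks) M → StackOf (cell s stk) S → reg s sp ≡ length S →
             reg s red ≡ R → reg s ry ≡ y → reg s ru ≡ toℕ u → Run growP s (Rep (grow M u S R y)) growTime
  grow-run {M} {u} {S} {R} {y} {s} e ms st sp≡ red≡ y≡ u≡ =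
    const then run-seq (run-weaken (+-monoʳ-≤ 3 (*-monoˡ-≤ 3 (<⇒≤ (toℕ<n u)))) (λ q → q) (offset-run e u≡)) λ f off≡ →
      run-seq (scan-run {u} {M} {S} (env-frame f e) off≡
                 (subst (λ c → MarksOf c M) (sym (arrays f marks refl)) ms)
                 (subst (λ c → StackOf c S) (sym (arrays f stk refl)) st)
                 (trans (regs f sp refl) sp≡)) λ g rep →
        settle-run {scan u n ≤-refl (frontier M S 0)} (env-frame g (env-frame f e)) rep
          (trans (regs g red refl) (trans (regs f red refl) red≡))
          (trans (regs g forced refl) (regs f forced refl))
          (trans (regs g ry refl) (trans (regs f ry refl) y≡))

  stepTime : ℕ
  stepTime = 8 + (1 + growTime)

  draw-run : ∀ {M u S R y s} → Env s → MarksOf (cell s marks) M → StackOf (cell s stk) S → reg s sp ≡ length S →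
             reg s red ≡ R → reg s forced ≡ 0 → reg s ry ≡ y → reg s ru ≡ toℕ u →
             Run drawP s (Rep (branch (P ≤ᵇ y + y) M u S R (y + y))) (5 + growTime)
  draw-run {M} {u} {S} {R} {y} {s} e@(n≡ , _ , one≡ , P≡ , _) ms st sp≡ red≡ forced≡ y≡ u≡ =
    add then add then monus then choose
    where
    yy≡ : reg s ry + reg s ry ≡ y + y
    yy≡ = cong₂ _+_ y≡ y≡
    t≡ : (reg s ry + reg s ry + reg s one) ∸ reg s rP ≡ suc (y + y) ∸ P
    t≡ = cong₂ _∸_ (plus-one yy≡ one≡) P≡
    choose : Run _ _ (Rep (branch (P ≤ᵇ y + y) M u S R (y + y))) (2 + growTime)
    choose with P ≤ᵇ y + y in le
    ... | true  = run-if≢0 (nonzero {m = y + y ∸ P}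
                      (trans t≡ (+-∸-assoc 1 {y + y} {P} (≤ᵇ⇒≤ P (y + y) (Equivalence.from T-≡ le)))))
                    (monus then grow-run {M} {u} {S} e ms st sp≡ red≡ (cong₂ _∸_ yy≡ P≡) u≡)
    ... | false = run-if≡0 (trans t≡ (m≤n⇒m∸n≡0 {suc (y + y)} {P} (≰⇒> {P} {y + y} (λ P≤ → subst T le (≤⇒≤ᵇ P≤)))))
                    (run-weaken (s≤s z≤n) (λ q → q) (now add (ms , st , sp≡ , plus-one red≡ one≡ , forced≡ , yy≡)))

  step-run : ∀ {c s} → Env s → Rep c s → Run stepP s (Rep (step c)) stepTime
  step-run {config M [] R F y} e (ms , st , sp≡ , rest) =
    run-weaken (s≤s (s≤s z≤n)) (λ q → q) (run-if≡0 sp≡ (now skip (ms , st , sp≡ , rest)))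
  step-run {config M (u ∷ S) R F y} {s} e@(_ , _ , one≡ , _) (ms , (top , st) , sp≡ , red≡ , forced≡ , y≡) =
    run-if≢0 (nonzero sp≡) (monus then load then choose F forced≡)
    where
    sp≡′ : reg s sp ∸ reg s one ≡ length S
    sp≡′ = pred-one sp≡ one≡
    u≡ : cell s stk (reg s sp ∸ reg s one) ≡ toℕ u
    u≡ = trans (cong (cell s stk) sp≡′) top
    choose : ∀ F → reg s forced ≡ bit F → Run _ _ (Rep (step (config M (u ∷ S) R F y))) (6 + growTime)
    choose true  f≡ = run-if≢0 (nonzero f≡) (run-weaken (m≤n+m growTime 5) (λ q → q)
                        (grow-run {M} {u} {S} e ms st sp≡′ red≡ y≡ u≡))
    choose false f≡ = run-if≡0 f≡ (draw-run {M} {u} {S} e ms st sp≡′ red≡ f≡ y≡ u≡)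

  searchTime : ℕ
  searchTime = 2 + n * 3 + (9 + n * (2 + stepTime))

  -- Marks of an earlier search must be wiped first, whereas for the stack resetting `sp` is enough.
  search-run : ∀ {r x s} → Env s → reg s rr ≡ toℕ r → reg s rx ≡ x →
               Run searchP s (λ s′ → reg s′ red ≡ outcome r x) searchTime
  search-run {r} {x} {s} e@(n≡ , _ , _ , _ , nil≡ , _) r≡ x≡ =
    run-seq clear λ {s₁} f clean → let e₁@(n≡₁ , _ , one≡₁ , _ , nil≡₁ , _) = env-frame f e
                                       r≡₁ = trans (regs f rr refl) r≡ in
      store then const then store then const then const then const then add then add then
      run-weaken ≤-refl (λ { (_ , (_ , _ , _ , red≡ , _) , refl) → red≡ })
        (countdown Inv n (body e₁) (plus-zero n≡₁ nil≡₁)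
          (start r x , ( mark-marks {c = cell s₁ marks} {M = λ _ → false} r≡₁ one≡₁ clean
                       , push-stack {c = cell s₁ stk} {S = []} refl r≡₁ tt , refl , refl , refl
                       , plus-zero (trans (regs f rx refl) x≡) nil≡₁) , refl))
    where
    Clean : ℕ → State → Set
    Clean j s = ∀ (v : Fin n) → j ≤ toℕ v → cell s marks (toℕ v) ≡ 0
    wipe : Program
    wipe = monus ri ri one ⨾ store marks ri nil
    clear : Run clearP s (λ s′ → MarksOf {n} (cell s′ marks) (λ _ → false)) (2 + n * 3)
    clear = add then run-weaken ≤-refl (λ clean v → clean v z≤n)
      (countdown Clean n wipe-run (plus-zero n≡ nil≡) (λ v n≤v → contradiction n≤v (<⇒≱ (toℕ<n v))))
      where
      wipe-run : ∀ {j s₁} → j < n → Frame wipe _ s₁ → reg s₁ ri ≡ suc j → Clean (suc j) s₁ →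
                 Run wipe s₁ (λ s′ → reg s′ ri ≡ j × Clean j s′) 2
      wipe-run {j} {s₁} _ fr i≡ clean with env-frame fr e
      ... | _ , _ , one≡ , _ , nil≡ , _ = monus then now store (i≡j , wiped)
        where
        i≡j : reg s₁ ri ∸ reg s₁ one ≡ j
        i≡j = pred-one i≡ one≡
        wiped : ∀ (v : Fin n) → j ≤ toℕ v → (cell s₁ marks [ reg s₁ ri ∸ reg s₁ one ↦ reg s₁ nil ]) (toℕ v) ≡ 0
        wiped v j≤v with m≤n⇒m<n∨m≡n j≤v
        ... | inj₁ j<v  = trans (update-other (cell s₁ marks) _ (λ eq → <⇒≢ j<v (sym (trans eq i≡j)))) (clean v j<v)
        ... | inj₂ refl rewrite i≡j = trans (update-same (cell s₁ marks) (toℕ v) _) nil≡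
    Inv : ℕ → State → Set
    Inv j s = ∃[ c ] Rep c s × run j c ≡ run n (start r x)
    loop : Program
    loop = monus iter iter one ⨾ stepP
    body : ∀ {s₀} → Env s₀ → ∀ {j s₁} → j < n → Frame loop s₀ s₁ → reg s₁ iter ≡ suc j → Inv (suc j) s₁ →
           Run loop s₁ (λ s′ → reg s′ iter ≡ j × Inv j s′) (1 + stepTime)
    body e₀ {j} {s₁} _ fr i≡ (c , rep , eq) with env-frame fr e₀
    ... | e₁@(_ , _ , one≡ , _) =
      monus then run-weaken ≤-refl (λ (g , rep′) → trans (regs g iter refl) (pred-one i≡ one≡) , step c , rep′ , eq)
        (run-frame (step-run {c} {setReg iter (reg s₁ iter ∸ reg s₁ one) s₁} e₁ rep))

  judge-run : ∀ {s o} → Env s → reg s red ≡ o →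
              Run judgeP s (λ s′ → (k ≤ o × reg s′ found ≡ 1) ⊎ (o < k × reg s′ found ≡ reg s found)) 4
  judge-run {s} {o} (_ , k≡ , one≡ , _) red≡ = add then monus then choose
    where
    t≡ : (reg s red + reg s one) ∸ reg s rk ≡ suc o ∸ k
    t≡ = cong₂ _∸_ (plus-one red≡ one≡) k≡
    choose : Run _ _ (λ s′ → (k ≤ o × reg s′ found ≡ 1) ⊎ (o < k × reg s′ found ≡ reg s found)) 2
    choose with k ≤? o
    ... | yes k≤o = run-if≢0 (nonzero {m = o ∸ k} (trans t≡ (+-∸-assoc 1 {o} {k} k≤o))) (now const (inj₁ (k≤o , refl)))
    ... | no  k≰o = run-if≡0 (trans t≡ (m≤n⇒m∸n≡0 {suc o} {k} (≰⇒> k≰o))) (now skip (inj₂ (≰⇒> k≰o , refl)))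

  -- An accepting search proves the answer at once, so progress has to be recorded only while
  -- `found` is 0. `Tested` is a parameter because each of the two nested loops measures progress in
  -- its own way.
  Verdict : (Fin n → ℕ → Set) → State → Set
  Verdict Tested s = (reg s found ≡ 1 × HasOutTreeWithLeaves D k)
                   ⊎ (reg s found ≡ 0 × ∀ r y → y < P → Tested r y → outcome r y < k)

  tryTime : ℕ
  tryTime = 3 + P * (2 + (searchTime + 4))

  try-run : ∀ {j s} → j < n → Env s → reg s rr ≡ suc j → Verdict (λ r _ → suc j ≤ toℕ r) s →
            Run tryP s (λ s′ → reg s′ rr ≡ j × Verdict (λ r _ → j ≤ toℕ r) s′) tryTime
  try-run {j} {s} j<n e@(_ , _ , one≡ , P≡ , nil≡ , _) r≡ verdict =
    monus then add then run-weaken ≤-refl (λ {s′} (fr , v) → trans (regs fr rr refl) (pred-one r≡ one≡) , complete s′ v)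
      (run-frame (countdown Inv P body (plus-zero P≡ nil≡) (Sum.map₂ (λ (z , t) → z , λ r y → t′ t r y) verdict)))
    where
    r₀ : Fin n
    r₀ = fromℕ< j<n
    Tested : ℕ → Fin n → ℕ → Set
    -- Both loops count down: roots above j are finished, and for root j the choices from i upwards
    -- are.
    Tested i r y = suc j ≤ toℕ r ⊎ (toℕ r ≡ j × i ≤ y)
    Inv : ℕ → State → Set
    Inv i = Verdict (Tested i)
    t′ : (∀ r y → y < P → suc j ≤ toℕ r → outcome r y < k) → ∀ r y → y < P → Tested P r y → outcome r y < k
    t′ t r y y<P (inj₁ lt)       = t r y y<P lt
    t′ t r y y<P (inj₂ (_ , P≤)) = contradiction P≤ (<⇒≱ y<P)
    complete : ∀ s′ → Verdict (Tested 0) s′ → Verdict (λ r _ → j ≤ toℕ r) s′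
    complete _ = Sum.map₂ (λ (z , t) → z , λ r y y<P j≤r →
      t r y y<P (Sum.map (λ lt → lt) (λ eq → sym eq , z≤n) (m≤n⇒m<n∨m≡n j≤r)))
    attempt : Program
    attempt = monus rx rx one ⨾ searchP ⨾ judgeP
    body : ∀ {i s₁} → i < P → Frame attempt _ s₁ → reg s₁ rx ≡ suc i → Inv (suc i) s₁ →
           Run attempt s₁ (λ s′ → reg s′ rx ≡ i × Inv i s′) (1 + (searchTime + 4))
    body {i} {s₁} i<P fr i≡ inv with env-frame fr e
    ... | e₁@(_ , _ , one≡₁ , _) = monus then run-weaken ≤-refl (λ (g , v) → trans (regs g rx refl) x≡ , v)
      (run-frame (run-seq (search-run {r₀} {i} {s₂} e₁ rr≡ x≡) λ {s₃} g red≡ →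
        run-weaken ≤-refl (λ {s₄} → judged s₃ s₄ (regs g found refl)) (judge-run (env-frame g e₁) red≡)))
      where
      s₂ : State
      s₂ = setReg rx (reg s₁ rx ∸ reg s₁ one) s₁
      x≡ : reg s₁ rx ∸ reg s₁ one ≡ i
      x≡ = pred-one i≡ one≡₁
      rr≡ : reg s₁ rr ≡ toℕ r₀
      rr≡ = trans (regs fr rr refl) (trans (pred-one r≡ one≡) (sym (toℕ-fromℕ< j<n)))
      judged : ∀ s₃ s₄ → reg s₃ found ≡ reg s₁ found →
               (k ≤ outcome r₀ i × reg s₄ found ≡ 1) ⊎ (outcome r₀ i < k × reg s₄ found ≡ reg s₃ found) → Inv i s₄
      judged _ _ same (inj₁ (k≤ , f≡)) = inj₁ (f≡ , outcome-sound D P r₀ i k≤)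
      judged _ _ same (inj₂ (lt , f≡)) = Sum.map (λ (f₁ , a) → trans f≡ (trans same f₁) , a)
        (λ (f₀ , t) → trans f≡ (trans same f₀) , more t) inv
        where
        more : (∀ r y → y < P → Tested (suc i) r y → outcome r y < k) → ∀ r y → y < P → Tested i r y → outcome r y < k
        more t r y y<P (inj₁ j<r) = t r y y<P (inj₁ j<r)
        more t r y y<P (inj₂ (r≡j , i≤y)) with m≤n⇒m<n∨m≡n i≤y
        ... | inj₁ i<y = t r y y<P (inj₂ (r≡j , i<y))
        ... | inj₂ refl = subst (λ r → outcome r i < k)
                            (toℕ-injective (trans (toℕ-fromℕ< j<n) (sym r≡j))) lt

  searchTime≡ : searchTime ≡ 11 + 25 * n + 14 * (n * n)
  searchTime≡ = solve 1 (λ n →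
      let g = con 1 :+ (con 3 :+ n :* con 3 :+ (con 3 :+ n :* con 11 :+ con 4)) in
      con 2 :+ n :* con 3 :+ (con 9 :+ n :* (con 2 :+ (con 8 :+ (con 1 :+ g)))) :=
      con 11 :+ con 25 :* n :+ con 14 :* (n :* n)) refl n
    where open +-*-Solver

-- Correctness and time of the whole program

powerTime : ℕ → ℕ
powerTime k = 3 + (k + k) * 3

-- P arises by 2k doublings. The rest of the environment, apart from `one`, is inherited from
-- `input`, since `powerP` does not write it.
power-run : ∀ {n} (D : Digraph n) k → Run powerP (input D k)
  (λ s → Simulation.Env D k (2 ^ (k + k)) s × reg s found ≡ 0) (suc (powerTime k))
power-run {n} D k = run-weaken ≤-refl (λ (fr , one≡ , P≡) →
    (regs fr rn refl , regs fr rk refl , one≡ , P≡ , regs fr nil refl , arrays fr adj refl) , regs fr found refl)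
  (run-frame (const then const then add then run-weaken ≤-refl (λ (one≡ , e) → one≡ , trans (sym (*-identityʳ _)) e)
    (countdown Inv (k + k) body refl (refl , +-identityʳ _))))
  where
  Inv : ℕ → State → Set
  Inv j s = reg s one ≡ 1 × reg s rP * 2 ^ j ≡ 2 ^ (k + k)
  double : Program
  double = monus ri ri one ⨾ add rP rP rP
  body : ∀ {s₀ j s₁} → j < k + k → Frame double s₀ s₁ → reg s₁ ri ≡ suc j → Inv (suc j) s₁ →
         Run double s₁ (λ s′ → reg s′ ri ≡ j × Inv j s′) 2
  body {j = j} {s₁} _ _ i≡ (one≡ , e) = monus then now add (pred-one i≡ one≡ , one≡ ,
    trans (solve 2 (λ p q → (p :+ p) :* q := p :* (q :+ (q :+ con 0))) refl (reg s₁ rP) (2 ^ j)) e)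
    where open +-*-Solver

mainTime : ℕ → ℕ → ℕ
mainTime n k = suc (powerTime k) + (2 + n * (4 + 2 ^ (k + k) * (17 + 25 * n + 14 * (n * n))) + 1)

main-run : ∀ {n} (D : Digraph n) k → DecidesWithin mainP (input D k) (HasOutTreeWithLeaves D k) (mainTime n k)
main-run {n} D k = run-seq (power-run D k) λ {s₁} _ (e , found≡) →
    run-seq (search-all s₁ e found≡) λ {s₂} g (nil≡ , v) → now add (answer s₂ nil≡ v)
  where
  P : ℕ
  P = 2 ^ (k + k)
  open Simulation D k P
  Inv : ℕ → State → Set
  Inv j = Verdict (λ r _ → j ≤ toℕ r)
  search-all : ∀ s₁ → Env s₁ → reg s₁ found ≡ 0 →
               Run (add rr rn nil ⨾ while rr tryP) s₁ (λ s → reg s nil ≡ 0 × Inv 0 s)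
                   (2 + n * (4 + P * (17 + 25 * n + 14 * (n * n))))
  search-all s₁ e@(n≡ , _ , _ , _ , nil≡ , _) found≡ =
    run-weaken (≤-reflexive (cong (λ t → 2 + n * (4 + P * t)) time≡)) (λ (g , v) → trans (regs g nil refl) nil≡ , v)
      (run-frame (add then countdown Inv n body (plus-zero n≡ nil≡)
        (inj₂ (found≡ , λ r y _ n≤r → contradiction n≤r (<⇒≱ (toℕ<n r))))))
    where
    time≡ : 2 + (searchTime + 4) ≡ 17 + 25 * n + 14 * (n * n)
    time≡ = trans (+-comm 2 (searchTime + 4)) (trans (cong (λ t → t + 4 + 2) searchTime≡)
      (solve 1 (λ n → con 11 :+ con 25 :* n :+ con 14 :* (n :* n) :+ con 4 :+ con 2 :=
                      con 17 :+ con 25 :* n :+ con 14 :* (n :* n)) refl n))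
      where open +-*-Solver
    body : ∀ {j s} → j < n → Frame tryP _ s → reg s rr ≡ suc j → Inv (suc j) s →
           Run tryP s (λ s′ → reg s′ rr ≡ j × Inv j s′) tryTime
    body j<n fr r≡ inv = try-run j<n (env-frame fr e) r≡ inv
  answer : ∀ s → reg s nil ≡ 0 → Inv 0 s →
           (reg s found + reg s nil ≡ 1 × HasOutTreeWithLeaves D k) ⊎
           (reg s found + reg s nil ≡ 0 × ¬ HasOutTreeWithLeaves D k)
  answer _ nil≡ = Sum.map (λ (f≡ , a) → plus-zero f≡ nil≡ , a)
    (λ (f≡ , t) → plus-zero f≡ nil≡ , reject-sound D refl (λ r y y<P → t r y y<P z≤n))

-- Running time

-- Absorbs the cost of `powerP`, linear in k, into the exponential factor.
m≤2^2m : ∀ m → m ≤ 2 ^ (m + m)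
m≤2^2m zero    = z≤n
m≤2^2m (suc m) = ≤-trans (s≤s (m≤2^2m m)) (≤-trans (≤-reflexive (+-comm 1 _))
  (+-mono-≤ (^-monoʳ-≤ 2 (+-monoʳ-≤ m (n≤1+n m))) (≤-trans (m^n>0 2 (m + suc m)) (m≤m+n _ 0))))

-- Since n ≥ 1, every monomial is at most P n³, and 73 is the sum of the coefficients.
mainTime-≤ : ∀ n k .{{_ : NonZero n}} → mainTime n k ≤ 73 * (2 ^ (k + k) * n ^ 3)
mainTime-≤ n k = begin
  mainTime n k
    ≡⟨ solve 3 (λ k n P → con 1 :+ (con 3 :+ (k :+ k) :* con 3) :+
                 (con 2 :+ n :* (con 4 :+ P :* (con 17 :+ con 25 :* n :+ con 14 :* (n :* n))) :+ con 1) :=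
               con 7 :* con 1 :+ con 6 :* k :+ con 4 :* n :+ con 17 :* (P :* n) :+ con 25 :* (P :* (n :* n))
                 :+ con 14 :* (P :* (n :* (n :* n)))) refl k n P ⟩
  7 * 1 + 6 * k + 4 * n + 17 * (P * n) + 25 * (P * (n * n)) + 14 * (P * (n * (n * n)))
    ≤⟨ +-mono-≤ (+-mono-≤ (+-mono-≤ (+-mono-≤ (+-mono-≤
         (*-monoʳ-≤ 7 (≤-trans n≥1 n≤X)) (*-monoʳ-≤ 6 k≤X)) (*-monoʳ-≤ 4 n≤X))
         (*-monoʳ-≤ 17 (*-monoʳ-≤ P n≤n³))) (*-monoʳ-≤ 25 (*-monoʳ-≤ P n²≤n³)))
         (≤-refl {14 * (P * (n * (n * n)))}) ⟩
  7 * X + 6 * X + 4 * X + 17 * X + 25 * X + 14 * X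
    ≡⟨ solve 1 (λ X → con 7 :* X :+ con 6 :* X :+ con 4 :* X :+ con 17 :* X :+ con 25 :* X :+ con 14 :* X :=
                 con 73 :* X) refl X ⟩
  73 * X
    ≡⟨ cong (λ m → 73 * (P * (n * (n * m)))) (sym (*-identityʳ n)) ⟩
  73 * (P * n ^ 3) ∎
  where
  open ≤-Reasoning
  open +-*-Solver
  P X : ℕ
  P = 2 ^ (k + k)
  X = P * (n * (n * n))
  n≥1 : 1 ≤ n
  n≥1 = >-nonZero⁻¹ n
  P≥1 : 1 ≤ P
  P≥1 = m^n>0 2 (k + k)
  n²≤n³ : n * n ≤ n * (n * n)
  n²≤n³ = m≤n*m (n * n) n
  n≤n³ : n ≤ n * (n * n)
  n≤n³ = ≤-trans (m≤n*m n n) n²≤n³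
  n≤X : n ≤ X
  n≤X = ≤-trans n≤n³ (≤-trans (≤-reflexive (sym (*-identityˡ _))) (*-monoˡ-≤ _ P≥1))
  k≤X : k ≤ X
  k≤X = ≤-trans (m≤2^2m k) (≤-trans (≤-reflexive (sym (*-identityʳ P))) (*-monoʳ-≤ P (≤-trans n≥1 n≤n³)))

-- The constant 292 is 4 · 73, where the 4 comes from the additive 2 in the exponent.
mainTime-bound : ∀ c n k e .{{_ : NonZero n}} → 292 ≤ c → k + k ≤ 2 + e → mainTime n k ≤ c * 2 ^ e * n ^ c
mainTime-bound c n k e c≥ 2k≤ = begin
  mainTime n k                     ≤⟨ mainTime-≤ n k ⟩
  73 * (2 ^ (k + k) * n ^ 3)       ≤⟨ *-monoʳ-≤ 73 (*-monoˡ-≤ (n ^ 3) (^-monoʳ-≤ 2 2k≤)) ⟩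
  73 * (2 ^ (2 + e) * n ^ 3)       ≡⟨ solve 2 (λ p m → con 73 :* ((con 2 :* (con 2 :* p)) :* m) := con 292 :* p :* m)
                                              refl (2 ^ e) (n ^ 3) ⟩
  292 * 2 ^ e * n ^ 3              ≤⟨ *-mono-≤ (*-monoˡ-≤ (2 ^ e) c≥) (^-monoʳ-≤ n (≤-trans (m≤m+n 3 289) c≥)) ⟩
  c * 2 ^ e * n ^ c                ∎
  where
  open ≤-Reasoning
  open +-*-Solver

-- The additive 2 pays for k = 1, where the logarithm vanishes.
exponent-≤ : ∀ c k d .{{_ : NonZero k}} → 2 ≤ c → (2 ≤ k → 1 ≤ d) → k + k ≤ 2 + c * k * d
exponent-≤ c 1               d c≥ d≥ = s≤s (s≤s z≤n)
exponent-≤ c k@(suc (suc _)) d c≥ d≥ = begin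
  k + k             ≡⟨ cong (k +_) (+-identityʳ k) ⟨
  2 * k             ≡⟨ *-identityʳ (2 * k) ⟨
  2 * k * 1         ≤⟨ *-mono-≤ (*-monoˡ-≤ k c≥) (d≥ (s≤s (s≤s z≤n))) ⟩
  c * k * d         ≤⟨ m≤n+m _ 2 ⟩
  2 + c * k * d     ∎
  where open ≤-Reasoning

log-≥1 : ∀ {k} → 2 ≤ k → 1 ≤ ⌊log₂ k ⌋
log-≥1 = ⌊log₂⌋-mono-≤

decides-within : ∀ c n k e .{{_ : NonZero n}} (D : Digraph n) → 292 ≤ c → k + k ≤ 2 + e →
                 DecidesWithin mainP (input D k) (HasOutTreeWithLeaves D k) (c * 2 ^ e * n ^ c)
decides-within c n k e D c≥ 2k≤ = run-weaken (mainTime-bound c n k e c≥ 2k≤) (λ a → a) (main-run D k)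

-- One program serves both halves: for k ≥ 2 the logarithm and its square are at least 1, so 2k
-- stays below both exponents.
solvable : ∀ c → 292 ≤ c →
    (∃[ p ] ((n : ℕ) .{{_ : NonZero n}} (D : Digraph n) (k : ℕ) .{{_ : NonZero k}} →
    DecidesWithin p (input D k) (HasOutTreeWithLeaves D k)
    (c * 2 ^ (c * k * ⌊log₂ k ⌋ ^ 2) * n ^ c)))
    ×
    (∃[ p ] ((n : ℕ) .{{_ : NonZero n}} (D : Digraph n) → Acyclic D → (k : ℕ) .{{_ : NonZero k}} →
    DecidesWithin p (input D k) (HasOutTreeWithLeaves D k)
    (c * 2 ^ (c * k * ⌊log₂ k ⌋) * n ^ c)))
solvable c c≥ =
  (mainP , λ n D k → decides-within c n k _ D c≥ (exponent-≤ c k _ c≥2 (λ k≥2 → ^-monoˡ-≤ 2 (log-≥1 k≥2)))) ,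
  (mainP , λ n D _ k → decides-within c n k _ D c≥ (exponent-≤ c k _ c≥2 log-≥1))
  where
  c≥2 : 2 ≤ c
  c≥2 = ≤-trans (m≤m+n 2 290) c≥

mainTheorem6 : ∃[ c ]
    (∃[ p ] ((n : ℕ) .{{_ : NonZero n}} (D : Digraph n) (k : ℕ) .{{_ : NonZero k}} →
    DecidesWithin p (input D k) (HasOutTreeWithLeaves D k)
    (c * 2 ^ (c * k * ⌊log₂ k ⌋ ^ 2) * n ^ c)))
    ×
    (∃[ p ] ((n : ℕ) .{{_ : NonZero n}} (D : Digraph n) → Acyclic D → (k : ℕ) .{{_ : NonZero k}} →
    DecidesWithin p (input D k) (HasOutTreeWithLeaves D k)
    (c * 2 ^ (c * k * ⌊log₂ k ⌋) * n ^ c)))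
mainTheorem6 = 292 , solvable 292 ≤-refl
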